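{- For every $n\ge1$, the composite $\Lambda\circ\Phi:\mathrm{SPCT}((2^n))\to\mathrm{LTree}_n$ is a bijection, and for every $\tau\in\mathrm{SPCT}((2^n))$, writing $T=\Lambda(\Phi(\tau))$, $$(|\mathrm{des}_N(\tau)|,|\mathrm{des}_S(\tau)|,|\mathrm{des}_{NE}(\tau)|,|\mathrm{des}_{SE}(\tau)|)=(\mathrm{lasc}(T),\mathrm{ldes}(T),\mathrm{rasc}(T),\mathrm{rdes}(T)).$$
   Context: $\mathrm{SPCT}((2^n))$ is the set of fillings $\tau$ of the $n\times2$ array ($n$ rows of length 2) with the distinct integers $1,\dots,2n$ such that each row decreases left to right and (triple condition) whenever $i<r$ and the entries in cells $(i,1),(i,2),(r,2)$ are $a,b,c$, $a\ge c$ implies $b>c$. For such $\tau$, with $i$ an entry of the first column: $i\in\mathrm{des}_N(\tau)$ if $i+1$ is in the first column in a row above that of $i$; $i\in\mathrm{des}_S(\tau)$ if $i+1$ is in the first column in a row below that of $i$; $i\in\mathrm{des}_{NE}(\tau)$ if $i+1$ is in the second column in a row strictly above that of $i$; $i\in\mathrm{des}_{SE}(\tau)$ if $i+1$ is in the second column in a row strictly below that of $i$. A labeled Dyck path of semi-length $n$ is a Dyck path from $(0,0)$ to $(2n,0)$ (up-steps $(1,1)$, down-steps $(1,-1)$, never below the axis) whose down-steps carry distinct labels from $[n]$; $\mathrm{LDyck}_n$ is their set. Up-steps are labeled as follows: for $i=n,\dots,1$, the $i$-th up-step gets label $\min(\mathfrak{D}_i\setminus\mathfrak{U}_i)$, where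 $\mathfrak{D}_i$ is the set of labels of down-steps after it and $\mathfrak{U}_i$ the set of labels of up-steps after it. $\Phi(\tau)\in\mathrm{LDyck}_n$: for $1\le i\le2n$, the $i$-th step is an up-step if $i$ is in column 2 of $\tau$, otherwise a down-step labeled by the index of the row of $\tau$ containing $i$. A labeled binary tree on $n$ nodes is a rooted plane tree in which each node has at most one left child and at most one right child, with nodes labeled distinctly by $[n]$; $\mathrm{LTree}_n$ is their set. A left path is a binary tree with no right children. An edge from $p$ to its right child $q$ is a right ascent if $\mathrm{label}(p)<\mathrm{label}(q)$ and a right descent otherwise; an edge from $p$ to its left child $q$ is a left ascent if $\mathrm{label}(p)<\mathrm{label}(q)$ and a left descent otherwise. $\mathrm{rasc},\mathrm{rdes},\mathrm{lasc},\mathrm{ldes}$ count these. $\Lambda:\mathrm{LDyck}_n\to\mathrm{LTree}_n$: a run of $D$ is a maximal sequence of consecutive down-steps (with labels). List the runs from right to left as $R_1,\dots,R_m$ ($R_1$ ends at the last step). Each run $R_i$ gives a left path $T_i$ whose node labels from root to leaf are the labels of $R_i$ read right to left. Set $T:=T_1$; for $i=2,\dots,m$, let $j$ be the label of the up-step immediately after the rightmost down-step of $R_i$, and attach $T_i$ as the right subtree of the node labeled $j$ in the current $T$. $\Lambda(D)$ is the final tree. -}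

module Defs where

open import Data.Bool using (Bool; true; false; if_then_else_; not; _∧_)
open import Data.Nat using (ℕ; zero; suc; _+_; _*_; _<_; _≤_; _<ᵇ_; _≡ᵇ_; _⊓_)
open import Data.Fin using (Fin; toℕ)
open import Data.Maybe using (Maybe; just; nothing; maybe)
open import Data.Product using (_×_; _,_; proj₁; proj₂)
open import Data.List using (List; []; _∷_; _++_; [_]; map; filterᵇ; findᵇ; upTo; allFin; length; reverse; foldr; concatMap)
open import Data.List.Relation.Binary.Permutation.Propositional using (_↭_)
open import Data.Vec using (Vec; lookup; toList)
open import Data.Bool.ListAction using (any)

-- Fillings of the n × 2 array.  Row i (i : Fin n, row 1 = index 0 is the
-- TOP row) is the pair (entry in column 1 , entry in column 2).

Filling : ℕ → Set
Filling n = Vec (ℕ × ℕ) n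

col1 : ∀ {n} → Filling n → Fin n → ℕ
col1 τ i = proj₁ (lookup τ i)

col2 : ∀ {n} → Filling n → Fin n → ℕ
col2 τ i = proj₂ (lookup τ i)

entries : ∀ {n} → Filling n → List ℕ
entries τ = concatMap (λ p → proj₁ p ∷ proj₂ p ∷ []) (toList τ)

range1 : ℕ → List ℕ
range1 m = map suc (upTo m)

record IsSPCT (n : ℕ) (τ : Filling n) : Set where
  field
    distinct-1..2n : entries τ ↭ range1 (2 * n)
    rows-decrease  : ∀ i → col2 τ i < col1 τ i
    triple         : ∀ (i r : Fin n) → toℕ i < toℕ r →
                     col2 τ r ≤ col1 τ i → col2 τ r < col2 τ i

rows : ∀ n → List (Fin n)
rows n = allFin n

desGen : ∀ {n} → (Filling n → Fin n → ℕ) → (Fin n → Fin n → Bool) →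
         Filling n → List ℕ
desGen {n} col rel τ =
  map (col1 τ)
    (filterᵇ (λ i → any (λ r → rel r i ∧ (col τ r ≡ᵇ suc (col1 τ i))) (rows n))
             (rows n))

above : ∀ {n} → Fin n → Fin n → Bool
above r i = toℕ r <ᵇ toℕ i

below : ∀ {n} → Fin n → Fin n → Bool
below r i = toℕ i <ᵇ toℕ r

desN desS desNE desSE : ∀ {n} → Filling n → List ℕ
desN  = desGen col1 above
desS  = desGen col1 below
desNE = desGen col2 above
desSE = desGen col2 below

data Step : Set where
  up   : Step
  down : ℕ → Step

data LStep : Set where
  upL   : ℕ → LStep
  downL : ℕ → LStep

Φ : ∀ {n} → Filling n → List Step
Φ {n} τ = map step (range1 (2 * n))
  where
  step : ℕ → Step
  step k = if any (λ r → col2 τ r ≡ᵇ k) (rows n)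
           then up
           else down (maybe (λ r → suc (toℕ r)) 0 (findᵇ (λ r → col1 τ r ≡ᵇ k) (rows n)))

elemᵇ : ℕ → List ℕ → Bool
elemᵇ x xs = any (λ y → x ≡ᵇ y) xs

-- minimum of a list (0 for the empty list; never used on Dyck paths)
minList : List ℕ → ℕ
minList []       = 0
minList (x ∷ xs) = foldr _⊓_ x xs

-- label up-steps, processing the path from right to left.
-- Input: path in reverse order; Dset/Uset: labels of down-/up-steps
-- already seen (i.e. to the right).  Output: labeled path, reverse order.
labelRev : List ℕ → List ℕ → List Step → List LStep
labelRev Dset Uset []            = []
labelRev Dset Uset (down l ∷ s)  = downL l ∷ labelRev (l ∷ Dset) Uset s
labelRev Dset Uset (up ∷ s)      =
  let m = minList (filterᵇ (λ x → not (elemᵇ x Uset)) Dset)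
  in upL m ∷ labelRev Dset (m ∷ Uset) s

labelPath : List Step → List LStep
labelPath p = reverse (labelRev [] [] (reverse p))

data BTree : Set where
  leaf : BTree
  node : BTree → ℕ → BTree → BTree

labels : BTree → List ℕ
labels leaf         = []
labels (node l x r) = labels l ++ x ∷ labels r

IsLTree : ℕ → BTree → Set
IsLTree n T = labels T ↭ range1 n

ascTo : ℕ → BTree → ℕ
ascTo x leaf         = 0
ascTo x (node _ y _) = if x <ᵇ y then 1 else 0

desTo : ℕ → BTree → ℕ
desTo x leaf         = 0
desTo x (node _ y _) = if x <ᵇ y then 0 else 1

lasc ldes rasc rdes : BTree → ℕ
lasc leaf = 0
lasc (node l x r) = ascTo x l + lasc l + lasc r
ldes leaf = 0
ldes (node l x r) = desTo x l + ldes l + ldes r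
rasc leaf = 0
rasc (node l x r) = ascTo x r + rasc l + rasc r
rdes leaf = 0
rdes (node l x r) = desTo x r + rdes l + rdes r

leftPath : List ℕ → BTree
leftPath []       = leaf
leftPath (x ∷ xs) = node (leftPath xs) x leaf

attach : ℕ → BTree → BTree → BTree
attach j t leaf = leaf
attach j t (node l x r) =
  if x ≡ᵇ j then node l x t else node (attach j t l) x (attach j t r)

-- add a finished run (labels read right to left) to the tree; the Maybe
-- is the label of the up-step immediately after its rightmost down-step
-- (nothing for R₁, which ends at the last step).
flush : Maybe ℕ → List ℕ → BTree → BTree
flush _        []  T = T
flush nothing  run T = leftPath run
flush (just j) run T = attach j (leftPath run) T

build : List LStep → Maybe ℕ → List ℕ → BTree → BTree
build []            u run T = flush u run T
build (downL l ∷ s) u run T = build s u (run ++ [ l ]) T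
build (upL l ∷ s)   u run T = build s (just l) [] (flush u run T)

Λ : List Step → BTree
Λ D = build (reverse (labelPath D)) nothing [] leaf

ΛΦ : ∀ {n} → Filling n → BTree
ΛΦ τ = Λ (Φ τ)

{-# OPTIONS --safe #-}
module Submission where

-- The tree ΛΦ τ can be read off τ directly: its root is the row with first entry
-- 2n, and the left (right) child of row s is the row whose first entry is one less
-- than the first (second) entry of s.  This uses that, by the triple condition, the
-- up-step at the second entry of row r gets the label of r.  Trees of this shape
-- (Desc) determine τ: descending from 2n, the entry at position k is the row of the
-- child hanging there, or if that child is missing the second entry of the topmost
-- open row.  Conversely a tree is traversed by following left children and, at the
-- end of a left path, continuing with the right subtree of the least open label;
-- the times at which the nodes are entered and closed form τ.  The statistics agree
-- because consecutive entries k, k + 1 of τ are exactly the edges of the tree.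

open import Defs
open import Data.Bool using (Bool; true; false; if_then_else_; not; _∧_; T; T?)
open import Data.Bool.ListAction using (any)
open import Data.Bool.Properties using (T-≡; ∧-zeroʳ; ∧-identityʳ)
open import Data.Fin using (Fin; toℕ)
open import Data.Fin.Properties using (toℕ-injective) renaming (_≟_ to _≟F_)
open import Data.List
  using (List; []; _∷_; _++_; [_]; map; filterᵇ; findᵇ; upTo; applyUpTo; downFrom;
         allFin; length; reverse; foldr; concatMap; tabulate)
open import Data.List.Properties
  using (map-tabulate; map-∘; map-++; map-cong; map-cong-local; length-map; length-++; length-tabulate;
         concatMap-++; reverse-upTo; reverse-involutive; reverse-map; ++-assoc; ++-identityʳ)
open import Data.List.Membership.Propositional using (_∈_; _∉_)
open import Data.List.Membership.Propositional.Properties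
open import Data.List.Membership.Propositional.Properties.WithK using (unique∧set⇒bag)
open import Data.List.Relation.Binary.BagAndSetEquality using (∼bag⇒↭)
open import Data.List.Relation.Binary.Permutation.Propositional hiding (refl; trans; swap)
open import Data.List.Relation.Binary.Permutation.Propositional.Properties as Perm using (∈-resp-↭; shift)
import Data.List.Relation.Binary.Permutation.Setoid.Properties as PermS
open import Data.List.Relation.Unary.All as All using (All; []; _∷_)
open import Data.List.Relation.Unary.AllPairs using ([]; _∷_)
open import Data.List.Relation.Unary.Any as Any using (here; there)
open import Data.List.Relation.Unary.Any.Properties using (any⁺)
open import Data.List.Relation.Unary.Unique.Propositional using (Unique)
import Data.List.Relation.Unary.Unique.Propositional.Properties as Unique
open import Data.Maybe using (just; nothing; maybe)
open import Data.Nat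
open import Data.Nat.ListAction using (sum)
open import Data.Nat.ListAction.Properties using (sum-++; sum-↭)
open import Data.Nat.Properties hiding (_≟_)
open import Data.Nat.Solver using (module +-*-Solver)
open import Data.Product using (_×_; _,_; ∃; ∃₂; proj₁; proj₂)
open import Data.Sum using (_⊎_; inj₁; inj₂; [_,_]′) renaming (swap to ⊎-swap)
open import Data.Vec as Vec using (Vec; lookup; toList)
open import Data.Vec.Properties using (lookup∘tabulate; tabulate∘lookup; tabulate-cong)
open import Function using (_∘_; id)
open import Function.Bundles using (Equivalence; mk⇔)
open import Relation.Binary.Definitions using (DecidableEquality; tri<; tri≈; tri>)
open import Relation.Binary.PropositionalEquality hiding ([_])
open import Relation.Nullary using (¬_; yes; no; contradiction)
open import Relation.Nullary.Decidable using (map′)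

-- Row labels, integer ranges and lists without repetition

lab : ∀ {n} → Fin n → ℕ
lab r = suc (toℕ r)

lab-injective : ∀ {n} {r s : Fin n} → lab r ≡ lab s → r ≡ s
lab-injective = toℕ-injective ∘ suc-injective

map-lab-allFin : ∀ n → map lab (allFin n) ≡ range1 n
map-lab-allFin n = begin
  map lab (tabulate id)           ≡⟨ map-tabulate id lab ⟩
  tabulate (suc ∘ toℕ)            ≡⟨ map-tabulate toℕ suc ⟨
  map suc (tabulate toℕ)          ≡⟨ cong (map suc) (tabulate-toℕ id n) ⟩
  range1 n                        ∎
  where
  open ≡-Reasoning
  tabulate-toℕ : ∀ (f : ℕ → ℕ) n → tabulate {n = n} (f ∘ toℕ) ≡ applyUpTo f n
  tabulate-toℕ f zero    = refl
  tabulate-toℕ f (suc n) = cong (f 0 ∷_) (tabulate-toℕ (f ∘ suc) n)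

desc : ℕ → List ℕ
desc zero    = []
desc (suc k) = suc k ∷ desc k

reverse-range1 : ∀ m → reverse (range1 m) ≡ desc m
reverse-range1 m = begin
  reverse (map suc (upTo m))  ≡⟨ reverse-map suc (upTo m) ⟨
  map suc (reverse (upTo m))  ≡⟨ cong (map suc) (reverse-upTo m) ⟩
  map suc (downFrom m)        ≡⟨ map-suc-downFrom m ⟩
  desc m                      ∎
  where
  open ≡-Reasoning
  map-suc-downFrom : ∀ m → map suc (downFrom m) ≡ desc m
  map-suc-downFrom zero    = refl
  map-suc-downFrom (suc m) = cong (suc m ∷_) (map-suc-downFrom m)

desc↭range1 : ∀ m → desc m ↭ range1 m
desc↭range1 m = ↭-trans (↭-reflexive (sym (reverse-range1 m))) (Perm.↭-reverse (range1 m))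

∈-range1⁺ : ∀ {k m} → 0 < k → k ≤ m → k ∈ range1 m
∈-range1⁺ {suc k} _ k≤m = ∈-map⁺ suc (∈-upTo⁺ k≤m)

∈-range1⁻ : ∀ {k m} → k ∈ range1 m → 0 < k × k ≤ m
∈-range1⁻ k∈ with ∈-map⁻ suc k∈
... | _ , i∈ , refl = z<s , ∈-upTo⁻ i∈

range1-unique : ∀ m → Unique (range1 m)
range1-unique m = Unique.map⁺ suc-injective (Unique.upTo⁺ m)

Unique-resp-↭ : ∀ {A : Set} {xs ys : List A} → xs ↭ ys → Unique xs → Unique ys
Unique-resp-↭ {A} p = PermS.Unique-resp-↭ (setoid A) (↭⇒↭ₛ p)

Unique-++⁻-disjoint : ∀ {A : Set} (xs : List A) {ys x y} → Unique (xs ++ ys) → x ∈ xs → y ∈ ys → x ≢ y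
Unique-++⁻-disjoint (x ∷ xs) (x∉ ∷ u) (here refl) y∈ = All.lookup x∉ (∈-++⁺ʳ xs y∈)
Unique-++⁻-disjoint (x ∷ xs) (x∉ ∷ u) (there x∈)  y∈ = Unique-++⁻-disjoint xs u x∈ y∈

Unique-++⁻ˡ : ∀ {A : Set} (xs : List A) {ys} → Unique (xs ++ ys) → Unique xs
Unique-++⁻ˡ []       u        = []
Unique-++⁻ˡ (x ∷ xs) (x∉ ∷ u) = All.tabulate (λ y∈ → All.lookup x∉ (∈-++⁺ˡ y∈)) ∷ Unique-++⁻ˡ xs u

Unique-++⁻ʳ : ∀ {A : Set} (xs : List A) {ys} → Unique (xs ++ ys) → Unique ys
Unique-++⁻ʳ []       u       = u
Unique-++⁻ʳ (x ∷ xs) (_ ∷ u) = Unique-++⁻ʳ xs u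

Unique-map⇒injective : ∀ {A B : Set} (f : A → B) {xs x y} → Unique (map f xs) →
                       x ∈ xs → y ∈ xs → f x ≡ f y → x ≡ y
Unique-map⇒injective f (x∉ ∷ u) (here refl) (here refl) _  = refl
Unique-map⇒injective f (x∉ ∷ u) (here refl) (there y∈)  eq = contradiction eq (All.lookup x∉ (∈-map⁺ f y∈))
Unique-map⇒injective f (x∉ ∷ u) (there x∈)  (here refl) eq = contradiction (sym eq) (All.lookup x∉ (∈-map⁺ f x∈))
Unique-map⇒injective f (x∉ ∷ u) (there x∈)  (there y∈)  eq = Unique-map⇒injective f u x∈ y∈ eq

concatMap-pair-↭ : ∀ {A B : Set} (f g : A → B) xs →
                   concatMap (λ x → f x ∷ g x ∷ []) xs ↭ map f xs ++ map g xs
concatMap-pair-↭ f g []       = ↭-refl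
concatMap-pair-↭ f g (x ∷ xs) =
  prep (f x) (↭-trans (prep (g x) (concatMap-pair-↭ f g xs)) (↭-sym (shift (g x) (map f xs) (map g xs))))

toList-lookup : ∀ {n} {A : Set} (v : Vec A n) → toList v ≡ map (lookup v) (allFin n)
toList-lookup {n} v = trans (go v) (sym (map-tabulate id (lookup v)))
  where
  go : ∀ {n} {A : Set} (v : Vec A n) → toList v ≡ tabulate (lookup v)
  go Vec.[]      = refl
  go (x Vec.∷ v) = cong (x ∷_) (go v)

entries-↭ : ∀ {n} (τ : Filling n) → entries τ ↭ map (col1 τ) (rows n) ++ map (col2 τ) (rows n)
entries-↭ {n} τ = begin
  entries τ                                                   ↭⟨ concatMap-pair-↭ proj₁ proj₂ (toList τ) ⟩
  map proj₁ (toList τ) ++ map proj₂ (toList τ)                ≡⟨ cong₂ _++_ (column proj₁) (column proj₂) ⟩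
  map (col1 τ) (rows n) ++ map (col2 τ) (rows n)              ∎
  where
  open PermutationReasoning
  column : ∀ (π : ℕ × ℕ → ℕ) → map π (toList τ) ≡ map (π ∘ lookup τ) (rows n)
  column π = trans (cong (map π) (toList-lookup τ)) (sym (map-∘ (rows n)))

-- Fillings as pairs of column functions

-- The permutation condition of `IsSPCT` unfolded into injectivity, disjointness, bounds and
-- covering, so that all later arguments are pointwise.
record Good {n : ℕ} (a b : Fin n → ℕ) : Set where
  field
    a-injective : ∀ {r s} → a r ≡ a s → r ≡ s
    b-injective : ∀ {r s} → b r ≡ b s → r ≡ s
    a≢b         : ∀ {r s} → a r ≢ b s
    b<a         : ∀ r → b r < a r
    b>0         : ∀ r → 0 < b r
    a≤2n        : ∀ r → a r ≤ 2 * n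
    cover       : ∀ {k} → 0 < k → k ≤ 2 * n → (∃ λ r → a r ≡ k) ⊎ (∃ λ r → b r ≡ k)
    triple      : ∀ {i r} → toℕ i < toℕ r → b r ≤ a i → b r < b i

  a>0 : ∀ r → 0 < a r
  a>0 r = <-trans (b>0 r) (b<a r)

SPCT⇒Good : ∀ {n} {τ : Filling n} → IsSPCT n τ → Good (col1 τ) (col2 τ)
SPCT⇒Good {n} {τ} spct = record
  { a-injective = Unique-map⇒injective (col1 τ) (Unique-++⁻ˡ _ uniq) (∈-allFin _) (∈-allFin _)
  ; b-injective = Unique-map⇒injective (col2 τ) (Unique-++⁻ʳ (map (col1 τ) (rows n)) uniq) (∈-allFin _) (∈-allFin _)
  ; a≢b         = Unique-++⁻-disjoint _ uniq (∈-map⁺ (col1 τ) (∈-allFin _)) (∈-map⁺ (col2 τ) (∈-allFin _))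
  ; b<a         = rows-decrease
  ; b>0         = λ r → proj₁ (∈-range1⁻ (∈-resp-↭ perm
                    (∈-++⁺ʳ (map (col1 τ) (rows n)) (∈-map⁺ _ (∈-allFin r)))))
  ; a≤2n        = λ r → proj₂ (∈-range1⁻ (∈-resp-↭ perm (∈-++⁺ˡ (∈-map⁺ _ (∈-allFin r)))))
  ; cover       = λ k>0 k≤2n → cover (∈-++⁻ (map (col1 τ) (rows n))
                    (∈-resp-↭ (↭-sym perm) (∈-range1⁺ k>0 k≤2n)))
  ; triple      = triple _ _
  }
  where
  open IsSPCT spct
  perm : map (col1 τ) (rows n) ++ map (col2 τ) (rows n) ↭ range1 (2 * n)
  perm = ↭-trans (↭-sym (entries-↭ τ)) distinct-1
  uniq : Unique (map (col1 τ) (rows n) ++ map (col2 τ) (rows n))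
  uniq = Unique-resp-↭ (↭-sym perm) (range1-unique (2 * n))
  cover : ∀ {k} → k ∈ map (col1 τ) (rows n) ⊎ k ∈ map (col2 τ) (rows n) →
          (∃ λ r → col1 τ r ≡ k) ⊎ (∃ λ r → col2 τ r ≡ k)
  cover (inj₁ k∈) with ∈-map⁻ _ k∈
  ... | r , _ , eq = inj₁ (r , sym eq)
  cover (inj₂ k∈) with ∈-map⁻ _ k∈
  ... | r , _ , eq = inj₂ (r , sym eq)

-- The tree of a filling

-- Desc a b k p t: t is the subtree whose root has first entry p, restricted to
-- the rows with first entry > k, i.e. to the down-steps read so far from the right.
data Desc {n : ℕ} (a b : Fin n → ℕ) (k : ℕ) : ℕ → BTree → Set where
  leaf : ∀ {p} → (∀ r → a r ≡ p → p ≤ k) → Desc a b k p leaf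
  node : ∀ {l r} s → k < a s → Desc a b k (pred (a s)) l → Desc a b k (pred (b s)) r →
         Desc a b k (a s) (node l (lab s) r)

-- The root entry determines the root row, hence both child positions, and so on downwards. A leaf
-- cannot face a node, since `leaf` excludes rows whose first entry is `p` and exceeds `k`.
Desc-functional : ∀ {n} {a b : Fin n → ℕ} → (∀ {r s} → a r ≡ a s → r ≡ s) → ∀ {k p q t t′} →
                  p ≡ q → Desc a b k p t → Desc a b k q t′ → t ≡ t′
Desc-functional inj eq (leaf _)        (leaf _)          = refl
Desc-functional inj eq (leaf f)        (node s k< _ _)   = contradiction k< (≤⇒≯ (subst (_≤ _) eq (f s (sym eq))))
Desc-functional inj eq (node s k< _ _) (leaf f)          = contradiction k< (≤⇒≯ (subst (_≤ _) (sym eq) (f s eq)))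
Desc-functional inj eq (node s _ dl dr) (node s′ _ dl′ dr′) with inj eq
... | refl = cong₂ (λ l r → node l (lab s) r) (Desc-functional inj refl dl dl′) (Desc-functional inj refl dr dr′)

-- Boolean tests, search and minima

≡ᵇ-true : ∀ {m n} → m ≡ n → (m ≡ᵇ n) ≡ true
≡ᵇ-true {m} {n} eq = Equivalence.to T-≡ (≡⇒≡ᵇ m n eq)

≡ᵇ-false : ∀ {m n} → m ≢ n → (m ≡ᵇ n) ≡ false
≡ᵇ-false {m} {n} m≢n with m ≡ᵇ n in eq
... | true  = contradiction (≡ᵇ⇒≡ m n (Equivalence.from T-≡ eq)) m≢n
... | false = refl

any-true : ∀ {A : Set} (p : A → Bool) {x xs} → x ∈ xs → p x ≡ true → any p xs ≡ true
any-true p x∈ px = Equivalence.to T-≡ (any⁺ p (Any.map (λ { refl → Equivalence.from T-≡ px }) x∈))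

any-false : ∀ {A : Set} (p : A → Bool) xs → (∀ {x} → x ∈ xs → p x ≡ false) → any p xs ≡ false
any-false p []       _  = refl
any-false p (x ∷ xs) px rewrite px (here refl) = any-false p xs (px ∘ there)

findᵇ-unique : ∀ {A : Set} (p : A → Bool) {x xs} → x ∈ xs → p x ≡ true →
               (∀ y → p y ≡ true → y ≡ x) → findᵇ p xs ≡ just x
findᵇ-unique p {xs = y ∷ xs} x∈ px only with p y in eq
... | true = cong just (only y eq)
findᵇ-unique p (here refl) px only | false with () ← trans (sym px) eq
findᵇ-unique p (there x∈)  px only | false = findᵇ-unique p x∈ px only

elemᵇ-true : ∀ {x xs} → x ∈ xs → elemᵇ x xs ≡ true
elemᵇ-true {x} x∈ = any-true (x ≡ᵇ_) x∈ (≡ᵇ-true {x} refl)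

elemᵇ-false : ∀ {x} xs → x ∉ xs → elemᵇ x xs ≡ false
elemᵇ-false {x} xs x∉ = any-false (x ≡ᵇ_) xs (λ y∈ → ≡ᵇ-false {x} (λ { refl → x∉ y∈ }))

minList-≡ : ∀ {m xs} → m ∈ xs → (∀ {x} → x ∈ xs → m ≤ x) → minList xs ≡ m
minList-≡ {m} {x ∷ xs} m∈ m≤ = ≤-antisym (lower x xs m∈) (greatest x xs m≤)
  where
  lower : ∀ x xs {y} → y ∈ x ∷ xs → foldr _⊓_ x xs ≤ y
  lower x []        (here refl)         = ≤-refl
  lower x (z ∷ xs)  (here refl)         = ≤-trans (m⊓n≤n z _) (lower x xs (here refl))
  lower x (z ∷ xs)  (there (here refl)) = m⊓n≤m z _
  lower x (z ∷ xs)  (there (there y∈))  = ≤-trans (m⊓n≤n z _) (lower x xs (there y∈))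
  greatest : ∀ x xs → (∀ {y} → y ∈ x ∷ xs → m ≤ y) → m ≤ foldr _⊓_ x xs
  greatest x []       m≤ = m≤ (here refl)
  greatest x (z ∷ xs) m≤ = ⊓-glb (m≤ (there (here refl)))
    (greatest x xs λ { (here refl) → m≤ (here refl) ; (there y∈) → m≤ (there (there y∈)) })

-- The labelled path read from right to left

stepOf : ∀ {n} → Filling n → ℕ → Step
stepOf {n} τ k = if any (λ r → col2 τ r ≡ᵇ k) (rows n)
                 then up
                 else down (maybe lab 0 (findᵇ (λ r → col1 τ r ≡ᵇ k) (rows n)))

-- The reversals that end `labelPath` and begin `Λ` cancel, so labelling and tree building both
-- proceed from right to left.
Λ-labelRev : ∀ D → Λ D ≡ build (labelRev [] [] (reverse D)) nothing [] leaf
Λ-labelRev D = cong (λ w → build w nothing [] leaf) (reverse-involutive (labelRev [] [] (reverse D)))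

-- The steps at positions `k`, ..., 1, where the up-step at position `b r` carries the label of row
-- `r`. That the minimum rule yields these labels is `label-up`.
data Word {n : ℕ} (a b : Fin n → ℕ) : ℕ → List LStep → Set where
  []  : Word a b 0 []
  dn  : ∀ {k w} r → a r ≡ suc k → Word a b k w → Word a b (suc k) (downL (lab r) ∷ w)
  up′ : ∀ {k w} r → b r ≡ suc k → Word a b k w → Word a b (suc k) (upL (lab r) ∷ w)

-- Describes the accumulators `Dset` and `Uset` of `labelRev` as sets, once the positions beyond `k`
-- have been read.
record Above {n : ℕ} (c : Fin n → ℕ) (k : ℕ) (xs : List ℕ) : Set where
  field
    complete : ∀ r → k < c r → lab r ∈ xs
    sound    : ∀ {x} → x ∈ xs → ∃ λ r → x ≡ lab r × k < c r

Above-hit : ∀ {n} {c : Fin n → ℕ} {k xs r} → (∀ {r s} → c r ≡ c s → r ≡ s) → c r ≡ suc k →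
            Above c (suc k) xs → Above c k (lab r ∷ xs)
Above-hit {c = c} {k} {xs} {r} inj cr≡ ab = record { complete = complete′ ; sound = sound′ }
  where
  open Above ab
  complete′ : ∀ s → k < c s → lab s ∈ lab r ∷ xs
  complete′ s k< with m≤n⇒m<n∨m≡n k<
  ... | inj₁ k+1< = there (complete s k+1<)
  ... | inj₂ k+1≡ = here (cong lab (inj (trans (sym k+1≡) (sym cr≡))))
  sound′ : ∀ {x} → x ∈ lab r ∷ xs → ∃ λ s → x ≡ lab s × k < c s
  sound′ (here refl) = r , refl , ≤-reflexive (sym cr≡)
  sound′ (there x∈) with sound x∈
  ... | s , eq , k+1< = s , eq , <⇒≤ k+1<

Above-miss : ∀ {n} {c : Fin n → ℕ} {k xs} → (∀ r → c r ≢ suc k) → Above c (suc k) xs → Above c k xs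
Above-miss {c = c} {k} {xs} miss ab = record
  { complete = λ s k< → complete s (≤∧≢⇒< k< (miss s ∘ sym))
  ; sound    = λ x∈ → let s , eq , k+1< = sound x∈ in s , eq , <⇒≤ k+1<
  }
  where open Above ab

module _ {n : ℕ} {τ : Filling n} (good : Good (col1 τ) (col2 τ)) where
  open Good good
  private
    a b : Fin n → ℕ
    a = col1 τ
    b = col2 τ

  stepOf-col2 : ∀ {k r} → b r ≡ k → stepOf τ k ≡ up
  stepOf-col2 {k} {r} eq rewrite any-true (λ r → b r ≡ᵇ k) (∈-allFin r) (≡ᵇ-true eq) = refl

  stepOf-col1 : ∀ {k r} → a r ≡ k → stepOf τ k ≡ down (lab r)
  stepOf-col1 {k} {r} refl
    rewrite any-false (λ s → b s ≡ᵇ k) (rows n) (λ {s} _ → ≡ᵇ-false (a≢b ∘ sym))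
          | findᵇ-unique (λ s → a s ≡ᵇ k) (∈-allFin r) (≡ᵇ-true {k} refl)
              (λ s eq → a-injective (≡ᵇ⇒≡ (a s) k (Equivalence.from T-≡ eq)))
    = refl

  -- By the triple condition the row r with b r = k + 1 is the topmost row that
  -- is open, i.e. whose down-step but not whose up-step lies to the right.
  label-up : ∀ {k r D U} → b r ≡ suc k → Above a (suc k) D → Above b (suc k) U →
             minList (filterᵇ (λ x → not (elemᵇ x U)) D) ≡ lab r
  label-up {k} {r} {D} {U} br≡ aboveD aboveU = minList-≡ r∈ least
    where
    open Above
    open? : ℕ → Bool
    open? x = not (elemᵇ x U)
    r∉U : lab r ∉ U
    r∉U r∈U with sound aboveU r∈U
    ... | s , eq , k+1< with lab-injective {r = r} {s} eq
    ...   | refl = <-irrefl (sym br≡) k+1<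
    r∈ : lab r ∈ filterᵇ open? D
    r∈ = ∈-filter⁺ _ (complete aboveD r (subst (_< a r) br≡ (b<a r)))
           (Equivalence.from T-≡ (cong not (elemᵇ-false U r∉U)))
    least : ∀ {x} → x ∈ filterᵇ open? D → lab r ≤ x
    least x∈ with ∈-filter⁻ (λ x → T? (open? x)) {xs = D} x∈
    ... | x∈D , Tx with sound aboveD x∈D
    ...   | s , refl , k+1<as = ≮⇒≥ λ s<r →
      let br<bs = triple {s} {r} (s<s⁻¹ s<r) (subst (_≤ a s) (sym br≡) (<⇒≤ k+1<as))
      in subst (T ∘ not) (elemᵇ-true (complete aboveU s (subst (_< b s) br≡ br<bs))) Tx

  labelRev-word : ∀ k {D U} → k ≤ 2 * n → Above a k D → Above b k U →
                  Word a b k (labelRev D U (map (stepOf τ) (desc k)))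
  labelRev-word zero    _  _  _  = []
  labelRev-word (suc k) k≤ aD aU with cover z<s k≤
  ... | inj₁ (r , ar≡) rewrite stepOf-col1 ar≡ =
    dn r ar≡ (labelRev-word k (<⇒≤ k≤) (Above-hit a-injective ar≡ aD)
               (Above-miss (λ s bs≡ → a≢b (trans ar≡ (sym bs≡))) aU))
  ... | inj₂ (r , br≡) rewrite stepOf-col2 br≡ | label-up br≡ aD aU =
    up′ r br≡ (labelRev-word k (<⇒≤ k≤) (Above-miss (λ s as≡ → a≢b (trans as≡ (sym br≡))) aD)
               (Above-hit b-injective br≡ aU))

  word : List LStep
  word = labelRev [] [] (map (stepOf τ) (desc (2 * n)))

  ΛΦ-word : ΛΦ τ ≡ build word nothing [] leaf
  ΛΦ-word = trans (Λ-labelRev (Φ τ)) (cong (λ s → build (labelRev [] [] s) nothing [] leaf)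
    (trans (sym (reverse-map (stepOf τ) (range1 (2 * n)))) (cong (map (stepOf τ)) (reverse-range1 (2 * n)))))

  Word-word : Word a b (2 * n) word
  Word-word = labelRev-word (2 * n) ≤-refl
    (record { complete = λ r lt → contradiction lt (≤⇒≯ (a≤2n r)) ; sound = λ () })
    (record { complete = λ r lt → contradiction lt (≤⇒≯ (≤-trans (<⇒≤ (b<a r)) (a≤2n r))) ; sound = λ () })

-- Building the tree run by run

-- A block of down-steps at the positions `p`, `p - 1`, ..., `k + 1`, in this order; it is empty
-- when `p` is `k`.
data IsRun {n : ℕ} (a : Fin n → ℕ) (k : ℕ) : ℕ → List ℕ → Set where
  []  : IsRun a k k []
  _∷_ : ∀ {p r run} → a r ≡ suc p → IsRun a k p run → IsRun a k (suc p) (lab r ∷ run)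

IsRun-snoc : ∀ {n} {a : Fin n → ℕ} {k p r run} → IsRun a (suc k) p run → a r ≡ suc k →
             IsRun a k p (run ++ [ lab r ])
IsRun-snoc []        ar≡ = ar≡ ∷ []
IsRun-snoc (eq ∷ ir) ar≡ = eq ∷ IsRun-snoc ir ar≡

IsRun-≤ : ∀ {n} {a : Fin n → ℕ} {k p run} → IsRun a k p run → k ≤ p
IsRun-≤ []       = ≤-refl
IsRun-≤ (_ ∷ ir) = m≤n⇒m≤1+n (IsRun-≤ ir)

IsRun-cover : ∀ {n} {a : Fin n → ℕ} {k p q run} → IsRun a k p run → k < q → q ≤ p → ∃ λ r → a r ≡ q
IsRun-cover []                 k<q q≤p = contradiction q≤p (<⇒≱ k<q)
IsRun-cover (_∷_ {r = r} eq ir) k<q q≤p with m≤n⇒m<n∨m≡n q≤p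
... | inj₁ q<  = IsRun-cover ir k<q (s≤s⁻¹ q<)
... | inj₂ q≡  = r , trans eq (sym q≡)

module _ {n : ℕ} {a b : Fin n → ℕ} (good : Good a b) where
  open Good good

  -- All positions of the run are first entries, so a second entry jumps over them.
  b-outside : ∀ {k p run} → IsRun a k p run → ∀ s → b s ≤ p → b s ≤ k
  b-outside ir s b≤p = ≮⇒≥ λ k<b → let r , ar≡ = IsRun-cover ir k<b b≤p in a≢b ar≡

  -- Consecutive first entries are left children of one another. The right subtrees are still empty:
  -- by `b<a` and `b-outside` the second entries of these rows lie to the left of the run.
  Desc-leftPath : ∀ {k p run} → IsRun a k p run → Desc a b k p (leftPath run)
  Desc-leftPath []                             = leaf λ _ _ → ≤-refl
  Desc-leftPath {k} (_∷_ {p = p} {r} {run} eq ir) =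
    subst (λ q → Desc a b k q (node (leftPath run) (lab r) leaf)) eq
      (node r (subst (k <_) (sym eq) (s≤s (IsRun-≤ ir)))
        (subst (λ q → Desc a b k q (leftPath run)) (cong pred (sym eq)) (Desc-leftPath ir))
        (leaf λ _ _ → ≤-trans (pred[n]≤n {b r})
          (b-outside ir r (s≤s⁻¹ (subst (b r <_) eq (b<a r))))))

  Desc-skip : ∀ {k p t} → (∀ r → a r ≢ suc k) → Desc a b (suc k) p t → Desc a b k p t
  Desc-skip miss (leaf f)            = leaf λ r eq → s≤s⁻¹ (≤∧≢⇒< (f r eq) (λ p≡ → miss r (trans eq p≡)))
  Desc-skip miss (node s k<as dl dr) = node s (<⇒≤ k<as) (Desc-skip miss dl) (Desc-skip miss dr)

  -- First entries strictly decrease from the root downwards, so the label of `j` does not occur in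
  -- `t`.
  attach-below : ∀ {k p t} j P → Desc a b k p t → p < a j → attach (lab j) P t ≡ t
  attach-below j P (leaf _)         p<  = refl
  attach-below j P (node s _ dl dr) as< with s ≟F j
  ... | yes refl = contradiction as< (<-irrefl refl)
  ... | no  s≢j rewrite ≡ᵇ-false (s≢j ∘ toℕ-injective) =
    cong₂ (λ l r → node l (lab s) r)
      (attach-below j P dl (≤-<-trans pred[n]≤n as<))
      (attach-below j P dr (≤-<-trans (≤-trans (pred[n]≤n {b s}) (<⇒≤ (b<a s))) as<))

  -- Lowering the threshold from `p₀ + 1` to `k` reveals exactly the rows of the run. They form `P`,
  -- whose position `p₀` is the right child position of `j`. The disjunction keeps `p` off the run,
  -- so that no other leaf has to become a node.
  Desc-attach : ∀ {k p₀ run j P p t} → IsRun a k p₀ run → b j ≡ suc p₀ →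
                Desc a b k p₀ P → p₀ < p ⊎ p ≤ k → Desc a b (suc p₀) p t →
                Desc a b k p (attach (lab j) P t)
  Desc-attach ir bj≡ dP p-ok (leaf f) = leaf λ r eq →
    [ (λ p₀<p → contradiction (trans eq (trans (≤-antisym (f r eq) p₀<p) (sym bj≡))) a≢b) , id ]′ p-ok
  Desc-attach {k} {p₀} {j = j} {P} ir bj≡ dP p-ok (node {l} {r} s p₀< dl dr) with s ≟F j
  ... | yes refl rewrite ≡ᵇ-true {toℕ s} refl =
    node s (≤-<-trans (m≤n⇒m≤1+n (IsRun-≤ ir)) p₀<)
      -- `attach` does not enter the left subtree of the matching node, whereas the induction
      -- describes that subtree after an attachment; the two agree because `s` does not occur there.
      (subst (Desc a b k _) (attach-below s P dl (≤-reflexive (suc-pred (a s) {{>-nonZero (a>0 s)}})))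
        (Desc-attach ir bj≡ dP (inj₁ (<⇒≤pred p₀<)) dl))
      (subst (λ q → Desc a b k q P) (cong pred (sym bj≡)) dP)
  ... | no s≢j rewrite ≡ᵇ-false (s≢j ∘ toℕ-injective) =
    node s (≤-<-trans (m≤n⇒m≤1+n (IsRun-≤ ir)) p₀<)
      (Desc-attach ir bj≡ dP (inj₁ (<⇒≤pred p₀<)) dl)
      (Desc-attach ir bj≡ dP right-ok dr)
    where
    right-ok : p₀ < pred (b s) ⊎ pred (b s) ≤ k
    -- Position `p₀ + 1` is the second entry of `j` alone, and the run contains no second entry, so
    -- `pred (b s)` lies beyond the run or at most at `k`.
    right-ok with b s ≤? p₀
    ... | yes bs≤ = inj₂ (≤-trans (pred[n]≤n {b s}) (b-outside ir s bs≤))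
    ... | no  bs≰ = inj₁ (<⇒≤pred (≤∧≢⇒< (≰⇒> bs≰) λ eq → s≢j (b-injective (trans (sym eq) (sym bj≡)))))

  Desc-flush : ∀ {k p₀ run j p t} → IsRun a k p₀ run → b j ≡ suc p₀ → p₀ < p →
               Desc a b (suc p₀) p t → Desc a b k p (flush (just (lab j)) run t)
  Desc-flush ir@[]      bj≡ p₀<p d = Desc-skip (λ r ar≡ → a≢b (trans ar≡ (sym bj≡))) d
  Desc-flush ir@(_ ∷ _) bj≡ p₀<p d = Desc-attach ir bj≡ (Desc-leftPath ir) (inj₁ p₀<p) d

  flush-nothing : ∀ run → flush nothing run leaf ≡ leftPath run
  flush-nothing []      = refl
  flush-nothing (_ ∷ _) = refl

  -- Invariant of `build`: the last up-step read is at `p₀ + 1`, the tree is correct down to there,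
  -- and the pending run fills the positions from `p₀` down to `k + 1`.
  Desc-build-just : ∀ {k w p₀ run j p t} → Word a b k w → IsRun a k p₀ run → b j ≡ suc p₀ → p₀ < p →
                    Desc a b (suc p₀) p t → Desc a b 0 p (build w (just (lab j)) run t)
  Desc-build-just []            ir bj≡ p₀<p d = Desc-flush ir bj≡ p₀<p d
  Desc-build-just (dn r ar≡ w)  ir bj≡ p₀<p d = Desc-build-just w (IsRun-snoc ir ar≡) bj≡ p₀<p d
  Desc-build-just (up′ r br≡ w) ir bj≡ p₀<p d =
    Desc-build-just w [] br≡ (<-trans (IsRun-≤ ir) p₀<p) (Desc-flush ir bj≡ p₀<p d)

  -- Before the first up-step is met there is only the rightmost run, which becomes the initial tree
  -- instead of being attached.
  Desc-build : ∀ {k w p run} → Word a b k w → IsRun a k p run →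
               Desc a b 0 p (build w nothing run leaf)
  Desc-build {run = run} []            ir rewrite flush-nothing run = Desc-leftPath ir
  Desc-build {run = run} (dn r ar≡ w)  ir = Desc-build w (IsRun-snoc ir ar≡)
  Desc-build {run = run} (up′ r br≡ w) ir rewrite flush-nothing run =
    Desc-build-just w [] br≡ (IsRun-≤ ir) (Desc-leftPath ir)

Desc-ΛΦ : ∀ {n} {τ : Filling n} → Good (col1 τ) (col2 τ) → Desc (col1 τ) (col2 τ) 0 (2 * n) (ΛΦ τ)
Desc-ΛΦ {n} {τ} good =
  subst (Desc (col1 τ) (col2 τ) 0 (2 * n)) (sym (ΛΦ-word {τ = τ} good))
    (Desc-build good (Word-word {τ = τ} good) [])

-- Counting by finite sums

χ : Bool → ℕ
χ true  = 1
χ false = 0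

∑ : ∀ {A : Set} → (A → ℕ) → List A → ℕ
∑ f xs = sum (map f xs)

∑-++ : ∀ {A : Set} (f : A → ℕ) xs ys → ∑ f (xs ++ ys) ≡ ∑ f xs + ∑ f ys
∑-++ f xs ys = trans (cong sum (map-++ f xs ys)) (sum-++ (map f xs) (map f ys))

∑-cong : ∀ {A : Set} {f g : A → ℕ} → (∀ x → f x ≡ g x) → ∀ xs → ∑ f xs ≡ ∑ g xs
∑-cong eq xs = cong sum (map-cong eq xs)

∑-↭ : ∀ {A : Set} (f : A → ℕ) {xs ys} → xs ↭ ys → ∑ f xs ≡ ∑ f ys
∑-↭ f p = sum-↭ (Perm.map⁺ f p)

∑-zero : ∀ {A : Set} {f : A → ℕ} xs → (∀ x → x ∈ xs → f x ≡ 0) → ∑ f xs ≡ 0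
∑-zero []       _  = refl
∑-zero (x ∷ xs) eq = cong₂ _+_ (eq x (here refl)) (∑-zero xs (λ y → eq y ∘ there))

∑χ-witness : ∀ {A : Set} (p : A → Bool) xs {m} → ∑ (χ ∘ p) xs ≡ suc m → ∃ λ x → x ∈ xs × p x ≡ true
∑χ-witness p (x ∷ xs) eq with p x in px
... | true  = x , here refl , px
... | false = let y , y∈ , py = ∑χ-witness p xs eq in y , there y∈ , py

∑χ-positive : ∀ {A : Set} (p : A → Bool) {x xs} → x ∈ xs → p x ≡ true → 0 < ∑ (χ ∘ p) xs
∑χ-positive p {xs = x ∷ xs} (here refl) px rewrite px = z<s
∑χ-positive p {xs = x ∷ xs} (there x∈)  px = ≤-trans (∑χ-positive p x∈ px) (m≤n+m _ (χ (p x)))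

-- Counts of at most one exclude repetitions, and positive counts give membership.
counts-one⇒↭-allFin : ∀ {n} {f : Fin n → ℕ} → (∀ {r s} → f r ≡ f s → r ≡ s) → ∀ {xs} →
                      (∀ r → ∑ (λ s → χ (f s ≡ᵇ f r)) xs ≡ 1) → xs ↭ allFin n
counts-one⇒↭-allFin {n} {f} inj {xs} one =
  ∼bag⇒↭ (unique∧set⇒bag (unique xs (λ r → ≤-reflexive (one r))) (Unique.allFin⁺ n)
    (λ {r} → mk⇔ (λ _ → ∈-allFin r) (λ _ → member r)))
  where
  unique : ∀ ys → (∀ r → ∑ (λ s → χ (f s ≡ᵇ f r)) ys ≤ 1) → Unique ys
  unique []       _  = []
  unique (y ∷ ys) ≤1 = All.tabulate (λ { z∈ refl → y∉ z∈ }) ∷ unique ys (λ r → ≤-trans (m≤n+m _ _) (≤1 r))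
    where
    y∉ : y ∉ ys
    y∉ y∈ = <⇒≱ (+-mono-≤ (≤-reflexive (sym (cong χ (≡ᵇ-true {f y} refl))))
                          (∑χ-positive (λ s → f s ≡ᵇ f y) y∈ (≡ᵇ-true {f y} refl))) (≤1 y)
  member : ∀ r → r ∈ xs
  member r with ∑χ-witness (λ s → f s ≡ᵇ f r) xs (one r)
  ... | s , s∈ , eq with inj (≡ᵇ⇒≡ (f s) (f r) (Equivalence.from T-≡ eq))
  ...   | refl = s∈

-- Every row is exactly one node of the tree

pred-≡ᵇ : ∀ {v} x → 0 < v → (pred x ≡ᵇ v) ≡ (x ≡ᵇ suc v)
pred-≡ᵇ zero    z<s = refl
pred-≡ᵇ (suc x) _   = refl

module _ {n : ℕ} {a b : Fin n → ℕ} where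

  rowsOf : ∀ {k p t} → Desc a b k p t → List (Fin n)
  rowsOf (leaf _)         = []
  rowsOf (node s _ dl dr) = rowsOf dl ++ s ∷ rowsOf dr

  labels-rowsOf : ∀ {k p t} (d : Desc a b k p t) → labels t ≡ map lab (rowsOf d)
  labels-rowsOf (leaf _)         = refl
  labels-rowsOf (node s _ dl dr) =
    trans (cong₂ (λ xs ys → xs ++ lab s ∷ ys) (labels-rowsOf dl) (labels-rowsOf dr))
          (sym (map-++ lab (rowsOf dl) (s ∷ rowsOf dr)))

module _ {n : ℕ} {a b : Fin n → ℕ} (good : Good a b) where
  open Good good

  -- A node with first entry v is the root or a child of a node in whose row v + 1 occurs.
  count-parents : ∀ {p t} r (d : Desc a b 0 p t) →
    ∑ (λ s → χ (a s ≡ᵇ a r)) (rowsOf d) ≡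
    χ (p ≡ᵇ a r) + (∑ (λ s → χ (a s ≡ᵇ suc (a r))) (rowsOf d) + ∑ (λ s → χ (b s ≡ᵇ suc (a r))) (rowsOf d))
  count-parents {p} r (leaf f) = sym (cong (λ z → χ z + 0)
    (≡ᵇ-false {p} λ p≡ → <⇒≱ (a>0 r) (subst (_≤ 0) p≡ (f r (sym p≡)))))
  count-parents r (node s _ dl dr) = begin
    ∑ A (L ++ s ∷ R)
      ≡⟨ ∑-++ A L (s ∷ R) ⟩
    ∑ A L + (A s + ∑ A R)
      ≡⟨ cong₂ (λ x y → x + (A s + y)) (count-parents r dl) (count-parents r dr) ⟩
    (χ (pred (a s) ≡ᵇ a r) + (∑ A⁺ L + ∑ B⁺ L)) + (A s + (χ (pred (b s) ≡ᵇ a r) + (∑ A⁺ R + ∑ B⁺ R)))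
      ≡⟨ cong₂ (λ x y → (χ x + (∑ A⁺ L + ∑ B⁺ L)) + (A s + (χ y + (∑ A⁺ R + ∑ B⁺ R))))
               (pred-≡ᵇ (a s) (a>0 r)) (pred-≡ᵇ (b s) (a>0 r)) ⟩
    (A⁺ s + (∑ A⁺ L + ∑ B⁺ L)) + (A s + (B⁺ s + (∑ A⁺ R + ∑ B⁺ R)))
      ≡⟨ solve 7 (λ x y z u v w q → (x :+ (y :+ z)) :+ (u :+ (v :+ (w :+ q))) :=
                                    u :+ ((y :+ (x :+ w)) :+ (z :+ (v :+ q)))) refl
           (A⁺ s) (∑ A⁺ L) (∑ B⁺ L) (A s) (B⁺ s) (∑ A⁺ R) (∑ B⁺ R) ⟩
    A s + ((∑ A⁺ L + (A⁺ s + ∑ A⁺ R)) + (∑ B⁺ L + (B⁺ s + ∑ B⁺ R)))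
      ≡⟨ cong₂ (λ x y → A s + (x + y)) (∑-++ A⁺ L (s ∷ R)) (∑-++ B⁺ L (s ∷ R)) ⟨
    A s + (∑ A⁺ (L ++ s ∷ R) + ∑ B⁺ (L ++ s ∷ R)) ∎
    where
    open ≡-Reasoning
    open +-*-Solver
    L = rowsOf dl
    R = rowsOf dr
    A A⁺ B⁺ : Fin n → ℕ
    A t  = χ (a t ≡ᵇ a r)
    A⁺ t = χ (a t ≡ᵇ suc (a r))
    B⁺ t = χ (b t ≡ᵇ suc (a r))

  -- Downward induction on `a r`, with `m` bounding the distance to `2 * n`. The value `2 * n`
  -- occurs only at the root. Otherwise `a r + 1` lies in a single row `s` with a larger first
  -- entry, and by `count-parents` row `r` occurs as often as `s`.
  rowsOf-↭ : ∀ {t} (d : Desc a b 0 (2 * n) t) → rowsOf d ↭ allFin n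
  rowsOf-↭ {t} d = counts-one⇒↭-allFin a-injective (λ r → once (2 * n) r (m≤n+m (2 * n) (a r)))
    where
    R = rowsOf d
    once : ∀ m r → 2 * n ≤ a r + m → ∑ (λ s → χ (a s ≡ᵇ a r)) R ≡ 1
    once m r ≤m with m≤n⇒m<n∨m≡n (a≤2n r)
    ... | inj₂ ar≡ = trans (count-parents r d)
      (cong₂ _+_ (cong χ (≡ᵇ-true (sym ar≡)))
        (cong₂ _+_ (∑-zero R (λ s _ → beyond (a s) (a≤2n s)))
                   (∑-zero R (λ s _ → beyond (b s) (≤-trans (<⇒≤ (b<a s)) (a≤2n s))))))
      where
      beyond : ∀ x → x ≤ 2 * n → χ (x ≡ᵇ suc (a r)) ≡ 0
      beyond x x≤ = cong χ (≡ᵇ-false λ eq → ≤⇒≯ x≤ (≤-reflexive (sym (trans eq (cong suc ar≡)))))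
    once zero    r ≤m | inj₁ ar< = contradiction (subst (2 * n ≤_) (+-identityʳ (a r)) ≤m) (<⇒≱ ar<)
    once (suc m) r ≤m | inj₁ ar< with cover z<s ar<
    ... | inj₁ (s , as≡) = trans (count-parents r d)
      (cong₂ _+_ (cong χ (≡ᵇ-false (<⇒≢ ar< ∘ sym)))
        (cong₂ _+_ (trans (cong (λ v → ∑ (λ q → χ (a q ≡ᵇ v)) R) (sym as≡))
                          (once m s (subst (2 * n ≤_) (trans (+-suc (a r) m) (cong (_+ m) (sym as≡))) ≤m)))
                   (∑-zero R (λ q _ → cong χ (≡ᵇ-false λ eq → a≢b (trans as≡ (sym eq)))))))
    ... | inj₂ (s , bs≡) = trans (count-parents r d)
      (cong₂ _+_ (cong χ (≡ᵇ-false (<⇒≢ ar< ∘ sym)))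
        (cong₂ _+_ (∑-zero R (λ q _ → cong χ (≡ᵇ-false λ eq → a≢b (trans eq (sym bs≡)))))
                   (trans (∑-cong same-row R)
                          (once m s (≤-trans ≤m (≤-trans (≤-reflexive (+-suc (a r) m))
                            (+-monoˡ-≤ m (≤-trans (≤-reflexive (sym bs≡)) (<⇒≤ (b<a s))))))))))
      where
      -- Either column identifies row `s`, so the count by second entries becomes the count by first
      -- entries to which the induction applies.
      same-row : ∀ q → χ (b q ≡ᵇ suc (a r)) ≡ χ (a q ≡ᵇ a s)
      same-row q with q ≟F s
      ... | yes refl = trans (cong χ (≡ᵇ-true bs≡)) (sym (cong χ (≡ᵇ-true {a q} refl)))
      ... | no  q≢s  = trans (cong χ (≡ᵇ-false (λ eq → q≢s (b-injective (trans eq (sym bs≡))))))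
                             (sym (cong χ (≡ᵇ-false (q≢s ∘ a-injective))))

  Desc-IsLTree : ∀ {t} → Desc a b 0 (2 * n) t → IsLTree n t
  Desc-IsLTree {t} d = begin
    labels t              ≡⟨ labels-rowsOf d ⟩
    map lab (rowsOf d)    ↭⟨ Perm.map⁺ lab (rowsOf-↭ d) ⟩
    map lab (allFin n)    ≡⟨ map-lab-allFin n ⟩
    range1 n              ∎
    where open PermutationReasoning

  Desc-member : ∀ {t} → Desc a b 0 (2 * n) t → ∀ s → lab s ∈ labels t
  Desc-member d s = subst (lab s ∈_) (sym (labels-rowsOf d))
    (∈-map⁺ lab (∈-resp-↭ (↭-sym (rowsOf-↭ d)) (∈-allFin s)))

-- Injectivity: the tree determines the filling

Desc-node⁻ : ∀ {n} {a b : Fin n → ℕ} {k p l x r} → Desc a b k p (node l x r) →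
             ∃ λ s → x ≡ lab s × p ≡ a s × Desc a b k (pred (a s)) l × Desc a b k (pred (b s)) r
Desc-node⁻ (node s _ dl dr) = s , refl , refl , dl , dr

module _ {n : ℕ} {a b a′ b′ : Fin n → ℕ} where

  -- Both fillings describe the same tree, so a node labelled by `s` has the same subtrees for both,
  -- though possibly at different positions.
  common-children : ∀ {p p′ t} s → Desc a b 0 p t → Desc a′ b′ 0 p′ t → lab s ∈ labels t → ∃₂ λ l r →
    (Desc a b 0 (pred (a s)) l × Desc a′ b′ 0 (pred (a′ s)) l) ×
    (Desc a b 0 (pred (b s)) r × Desc a′ b′ 0 (pred (b′ s)) r)
  common-children {t = node l _ r} s (node q _ dl dr) d′ s∈ with Desc-node⁻ d′
  ... | q′ , eq , _ , dl′ , dr′ with ∈-++⁻ (labels l) s∈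
  ...   | inj₁ s∈l         = common-children s dl dl′ s∈l
  ...   | inj₂ (there s∈r) = common-children s dr dr′ s∈r
  ...   | inj₂ (here s≡q) with lab-injective {r = s} {q} s≡q | lab-injective {r = q} {q′} eq
  ...     | refl | refl = l , r , (dl , dl′) , (dr , dr′)

-- The disjunction makes agreement symmetric: an entry exceeding `k` in one filling cannot be at
-- most `k` in the other.
AgreeAbove : ∀ {n} → (c c′ : Fin n → ℕ) → ℕ → Set
AgreeAbove c c′ k = ∀ r → k < c r ⊎ k < c′ r → c r ≡ c′ r

AgreeAbove-hit : ∀ {n} {c c′ : Fin n → ℕ} {k r} →
                 (∀ {r s} → c r ≡ c s → r ≡ s) → (∀ {r s} → c′ r ≡ c′ s → r ≡ s) →
                 c r ≡ suc k → c′ r ≡ suc k → AgreeAbove c c′ (suc k) → AgreeAbove c c′ k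
AgreeAbove-hit inj inj′ eq eq′ ag s (inj₁ k<) with m≤n⇒m<n∨m≡n k<
... | inj₁ k+1< = ag s (inj₁ k+1<)
... | inj₂ k+1≡ with inj (trans (sym k+1≡) (sym eq))
...   | refl = trans eq (sym eq′)
AgreeAbove-hit inj inj′ eq eq′ ag s (inj₂ k<) with m≤n⇒m<n∨m≡n k<
... | inj₁ k+1< = ag s (inj₂ k+1<)
... | inj₂ k+1≡ with inj′ (trans (sym k+1≡) (sym eq′))
...   | refl = trans eq (sym eq′)

AgreeAbove-miss : ∀ {n} {c c′ : Fin n → ℕ} {k} → (∀ r → c r ≢ suc k) → (∀ r → c′ r ≢ suc k) →
                  AgreeAbove c c′ (suc k) → AgreeAbove c c′ k
AgreeAbove-miss miss miss′ ag s (inj₁ k<) = ag s (inj₁ (≤∧≢⇒< k< (miss s ∘ sym)))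
AgreeAbove-miss miss miss′ ag s (inj₂ k<) = ag s (inj₂ (≤∧≢⇒< k< (miss′ s ∘ sym)))

-- Above k the two fillings agree, so row r is open in both and, lying above r′,
-- violates the triple condition in the second.
not-above : ∀ {n} {a b a′ b′ : Fin n → ℕ} → Good a b → Good a′ b′ → ∀ {k r r′} →
            AgreeAbove a a′ k → AgreeAbove b b′ k → b r ≡ k → b′ r′ ≡ k → ¬ (toℕ r < toℕ r′)
not-above {a = a} {b} {a′} {b′} good good′ {k} {r} {r′} agA agB br≡ b′r′≡ r<r′ =
  <-irrefl (sym br≡) (subst (k <_) (sym (agB r (inj₂ k<b′r))) k<b′r)
  where
  k<ar : k < a r
  k<ar = subst (_< a r) br≡ (Good.b<a good r)
  k<b′r : k < b′ r
  k<b′r = subst (_< b′ r) b′r′≡ (Good.triple good′ r<r′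
    (subst₂ _≤_ (sym b′r′≡) (agA r (inj₁ k<ar)) (<⇒≤ k<ar)))

module _ {n : ℕ} {a b a′ b′ : Fin n → ℕ} (good : Good a b) (good′ : Good a′ b′) where
  private
    module G  = Good good
    module G′ = Good good′

  -- If the common tree at `k` is a node, its label names the row with first entry `k` in both. If
  -- it is a leaf, `k` is a second entry in both, and `not-above` used in both directions forces the
  -- same row.
  same-entry : ∀ {k t} → 0 < k → k ≤ 2 * n → AgreeAbove a a′ k → AgreeAbove b b′ k →
               Desc a b 0 k t → Desc a′ b′ 0 k t →
               (∃ λ r → a r ≡ k × a′ r ≡ k) ⊎ (∃ λ r → b r ≡ k × b′ r ≡ k)
  same-entry {t = node _ _ _} k>0 k≤ agA agB d d′ with Desc-node⁻ d | Desc-node⁻ d′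
  ... | s , x≡ , k≡ , _ | s′ , x≡′ , k≡′ , _ with lab-injective {r = s} {s′} (trans (sym x≡) x≡′)
  ...   | refl = inj₁ (s , sym k≡ , sym k≡′)
  same-entry {t = leaf} k>0 k≤ agA agB (leaf f) (leaf f′) with G.cover k>0 k≤ | G′.cover k>0 k≤
  ... | inj₁ (r , ar≡) | _              = contradiction (f r ar≡) (<⇒≱ k>0)
  ... | _              | inj₁ (r , ar≡) = contradiction (f′ r ar≡) (<⇒≱ k>0)
  ... | inj₂ (r , br≡) | inj₂ (r′ , b′r′≡) with <-cmp (toℕ r) (toℕ r′)
  ...   | tri< r<r′ _ _ = contradiction r<r′ (not-above good good′ agA agB br≡ b′r′≡)
  ...   | tri> _ _ r′<r = contradiction r′<r (not-above good′ good (swapAgree agA) (swapAgree agB) b′r′≡ br≡)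
    where
    swapAgree : ∀ {c c′ : Fin n → ℕ} {k} → AgreeAbove c c′ k → AgreeAbove c′ c k
    swapAgree ag s = sym ∘ ag s ∘ ⊎-swap
  ...   | tri≈ _ r≡r′ _ with toℕ-injective r≡r′
  ...     | refl = inj₂ (r , br≡ , b′r′≡)

  -- Downward induction from `2 * n`: `m` counts the entries already compared, and each step places
  -- one further entry.
  agree-above : ∀ {t} → Desc a b 0 (2 * n) t → Desc a′ b′ 0 (2 * n) t →
                ∀ m k → k + m ≡ 2 * n → AgreeAbove a a′ k × AgreeAbove b b′ k
  agree-above d d′ zero    k k≡ rewrite +-identityʳ k =
    (λ { r (inj₁ k<) → contradiction (subst (_< a r)  k≡ k<) (≤⇒≯ (G.a≤2n r))
       ; r (inj₂ k<) → contradiction (subst (_< a′ r) k≡ k<) (≤⇒≯ (G′.a≤2n r)) }) ,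
    (λ { r (inj₁ k<) → contradiction (subst (_< b r)  k≡ k<) (≤⇒≯ (≤-trans (<⇒≤ (G.b<a r)) (G.a≤2n r)))
       ; r (inj₂ k<) → contradiction (subst (_< b′ r) k≡ k<) (≤⇒≯ (≤-trans (<⇒≤ (G′.b<a r)) (G′.a≤2n r))) })
  agree-above {t} d d′ (suc m) k k≡ with agree-above d d′ m (suc k) (trans (sym (+-suc k m)) k≡)
  ... | agA , agB = extend entry
    where
    k+1≤ : suc k ≤ 2 * n
    k+1≤ = subst (suc k ≤_) (trans (sym (+-suc k m)) k≡) (m≤m+n (suc k) m)
    common : ∃ λ t → Desc a b 0 (suc k) t × Desc a′ b′ 0 (suc k) t
    -- The tree at `2 * n` is the whole tree. Below that, the tree at `k + 1` is a child of the row
    -- containing `k + 2`, a row already known to be the same in both fillings.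
    common with m≤n⇒m<n∨m≡n k+1≤
    ... | inj₂ k+1≡ = t , subst (λ q → Desc a b 0 q t) (sym k+1≡) d , subst (λ q → Desc a′ b′ 0 q t) (sym k+1≡) d′
    ... | inj₁ k+1< with G.cover z<s k+1<
    ...   | inj₁ (s , as≡) with common-children s d d′ (Desc-member good d s)
    ...     | l , _ , (dl , dl′) , _ =
      l , subst (λ q → Desc a b 0 q l) (cong pred as≡) dl
        , subst (λ q → Desc a′ b′ 0 q l) (cong pred (trans (sym (agA s (inj₁ (≤-reflexive (sym as≡))))) as≡)) dl′
    common | inj₁ k+1< | inj₂ (s , bs≡) with common-children s d d′ (Desc-member good d s)
    ...     | _ , r , _ , (dr , dr′) =
      r , subst (λ q → Desc a b 0 q r) (cong pred bs≡) dr
        , subst (λ q → Desc a′ b′ 0 q r) (cong pred (trans (sym (agB s (inj₁ (≤-reflexive (sym bs≡))))) bs≡)) dr′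
    entry : (∃ λ r → a r ≡ suc k × a′ r ≡ suc k) ⊎ (∃ λ r → b r ≡ suc k × b′ r ≡ suc k)
    entry = let t , dt , dt′ = common in same-entry z<s k+1≤ agA agB dt dt′
    extend : (∃ λ r → a r ≡ suc k × a′ r ≡ suc k) ⊎ (∃ λ r → b r ≡ suc k × b′ r ≡ suc k) →
             AgreeAbove a a′ k × AgreeAbove b b′ k
    extend (inj₁ (r , eq , eq′)) =
      AgreeAbove-hit G.a-injective G′.a-injective eq eq′ agA ,
      AgreeAbove-miss (λ s e → G.a≢b (trans eq (sym e))) (λ s e → G′.a≢b (trans eq′ (sym e))) agB
    extend (inj₂ (r , eq , eq′)) =
      AgreeAbove-miss (λ s e → G.a≢b (trans e (sym eq))) (λ s e → G′.a≢b (trans e (sym eq′))) agA ,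
      AgreeAbove-hit G.b-injective G′.b-injective eq eq′ agB

  Desc-injective : ∀ {t} → Desc a b 0 (2 * n) t → Desc a′ b′ 0 (2 * n) t → ∀ r → a r ≡ a′ r × b r ≡ b′ r
  Desc-injective d d′ r with agree-above d d′ (2 * n) 0 refl
  ... | agA , agB = agA r (inj₁ (G.a>0 r)) , agB r (inj₁ (G.b>0 r))

-- Descents of the filling as edges of the tree

∑-+ : ∀ {A : Set} (f g : A → ℕ) xs → ∑ (λ x → f x + g x) xs ≡ ∑ f xs + ∑ g xs
∑-+ f g []       = refl
∑-+ f g (x ∷ xs) = trans (cong (f x + g x +_) (∑-+ f g xs))
  (solve 4 (λ w x y z → (w :+ x) :+ (y :+ z) := (w :+ y) :+ (x :+ z)) refl (f x) (g x) (∑ f xs) (∑ g xs))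
  where open +-*-Solver

∑-swap : ∀ {A B : Set} (f : A → B → ℕ) xs ys → ∑ (λ x → ∑ (f x) ys) xs ≡ ∑ (λ y → ∑ (λ x → f x y) xs) ys
∑-swap f []       ys = sym (∑-zero ys (λ _ _ → refl))
∑-swap f (x ∷ xs) ys = trans (cong (∑ (f x) ys +_) (∑-swap f xs ys))
  (sym (∑-+ (f x) (λ y → ∑ (λ x → f x y) xs) ys))

∑-single : ∀ {A : Set} (f : A → ℕ) {x xs} → Unique xs → x ∈ xs → (∀ y → y ≢ x → f y ≡ 0) → ∑ f xs ≡ f x
∑-single f {xs = x ∷ xs} (x∉ ∷ u) (here refl) eq0 =
  trans (cong (f x +_) (∑-zero xs (λ y y∈ → eq0 y (λ { refl → All.lookup x∉ y∈ refl })))) (+-identityʳ (f x))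
∑-single f {xs = y ∷ xs} (y∉ ∷ u) (there x∈)  eq0 =
  cong₂ _+_ (eq0 y (All.lookup y∉ x∈)) (∑-single f u x∈ eq0)

χ-any : ∀ {A : Set} (p : A → Bool) {xs} → Unique xs → (∀ {x y} → p x ≡ true → p y ≡ true → x ≡ y) →
        χ (any p xs) ≡ ∑ (χ ∘ p) xs
χ-any p {[]}     _        _  = refl
χ-any p {x ∷ xs} (x∉ ∷ u) ≤1 with p x in px
... | false = χ-any p u ≤1
... | true  = cong suc (sym (∑-zero xs λ y y∈ → cong χ (false-at y y∈)))
  where
  false-at : ∀ y → y ∈ xs → p y ≡ false
  false-at y y∈ with p y in py
  ... | true  = contradiction (≤1 px py) (All.lookup x∉ y∈)
  ... | false = refl

length-filterᵇ : ∀ {A : Set} (p : A → Bool) xs → length (filterᵇ p xs) ≡ ∑ (χ ∘ p) xs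
length-filterᵇ p []       = refl
length-filterᵇ p (x ∷ xs) with p x
... | true  = cong suc (length-filterᵇ p xs)
... | false = length-filterᵇ p xs

∧-true : ∀ {x y} → x ∧ y ≡ true → y ≡ true
∧-true {true} eq = eq

-- Injectivity of the column leaves at most one witness `s` for each `r`, so the Boolean search
-- equals a sum.
length-desGen : ∀ {n} (c : Filling n → Fin n → ℕ) rel (τ : Filling n) →
  (∀ {r s} → c τ r ≡ c τ s → r ≡ s) →
  length (desGen c rel τ) ≡ ∑ (λ r → ∑ (λ s → χ (rel s r ∧ (c τ s ≡ᵇ suc (col1 τ r)))) (rows n)) (rows n)
length-desGen {n} c rel τ inj = begin
  length (desGen c rel τ)                        ≡⟨ length-map (col1 τ) (filterᵇ _ (rows n)) ⟩
  length (filterᵇ (λ r → any (p r) (rows n)) (rows n)) ≡⟨ length-filterᵇ _ (rows n) ⟩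
  ∑ (λ r → χ (any (p r) (rows n))) (rows n)
    ≡⟨ ∑-cong (λ r → χ-any (p r) (Unique.allFin⁺ n) (at-most-one r)) (rows n) ⟩
  ∑ (λ r → ∑ (χ ∘ p r) (rows n)) (rows n)        ∎
  where
  open ≡-Reasoning
  p : Fin n → Fin n → Bool
  p r s = rel s r ∧ (c τ s ≡ᵇ suc (col1 τ r))
  c≡ : ∀ r {s} → p r s ≡ true → c τ s ≡ suc (col1 τ r)
  c≡ r {s} eq = ≡ᵇ⇒≡ (c τ s) _ (Equivalence.from T-≡ (∧-true {rel s r} eq))
  at-most-one : ∀ r {s s′} → p r s ≡ true → p r s′ ≡ true → s ≡ s′
  at-most-one r eq eq′ = inj (trans (c≡ r eq) (sym (c≡ r eq′)))

edgeTo : (Bool → Bool) → ℕ → BTree → ℕ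
edgeTo φ x leaf         = 0
edgeTo φ x (node _ y _) = χ (φ (x <ᵇ y))

-- The four tree statistics are the cases pick ∈ {left , right}, φ ∈ {id , not}.
edges : (BTree → BTree → BTree) → (Bool → Bool) → BTree → ℕ
edges pick φ leaf         = 0
edges pick φ (node l x r) = edgeTo φ x (pick l r) + edges pick φ l + edges pick φ r

left right : BTree → BTree → BTree
left  l r = l
right l r = r

ascTo-edgeTo : ∀ x t → ascTo x t ≡ edgeTo id x t
ascTo-edgeTo x leaf = refl
ascTo-edgeTo x (node _ y _) with x <ᵇ y
... | true  = refl
... | false = refl

desTo-edgeTo : ∀ x t → desTo x t ≡ edgeTo not x t
desTo-edgeTo x leaf = refl
desTo-edgeTo x (node _ y _) with x <ᵇ y
... | true  = refl
... | false = refl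

lasc-edges : ∀ t → lasc t ≡ edges left id t
lasc-edges leaf         = refl
lasc-edges (node l x r) = cong₂ _+_ (cong₂ _+_ (ascTo-edgeTo x l) (lasc-edges l)) (lasc-edges r)

ldes-edges : ∀ t → ldes t ≡ edges left not t
ldes-edges leaf         = refl
ldes-edges (node l x r) = cong₂ _+_ (cong₂ _+_ (desTo-edgeTo x l) (ldes-edges l)) (ldes-edges r)

rasc-edges : ∀ t → rasc t ≡ edges right id t
rasc-edges leaf         = refl
rasc-edges (node l x r) = cong₂ _+_ (cong₂ _+_ (ascTo-edgeTo x r) (rasc-edges l)) (rasc-edges r)

rdes-edges : ∀ t → rdes t ≡ edges right not t
rdes-edges leaf         = refl
rdes-edges (node l x r) = cong₂ _+_ (cong₂ _+_ (desTo-edgeTo x r) (rdes-edges l)) (rdes-edges r)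

module _ {n : ℕ} {τ : Filling n} (good : Good (col1 τ) (col2 τ)) where
  open Good good
  private
    a b : Fin n → ℕ
    a = col1 τ
    b = col2 τ

  -- At most one row has first entry `p`: the root of `t`, or no row when `t` is a leaf. This
  -- removes the tree from the edge count.
  edgeTo-∑ : ∀ φ x {p t} → Desc a b 0 p t →
             edgeTo φ x t ≡ ∑ (λ r → χ ((a r ≡ᵇ p) ∧ φ (x <ᵇ lab r))) (rows n)
  edgeTo-∑ φ x {p} (leaf f) = sym (∑-zero (rows n) λ r _ → cong (λ z → χ (z ∧ φ (x <ᵇ lab r)))
    (≡ᵇ-false {a r} {p} λ eq → <⇒≱ (a>0 r) (subst (_≤ 0) (sym eq) (f r eq))))
  edgeTo-∑ φ x (node s _ _ _) = sym (trans
    (∑-single _ (Unique.allFin⁺ n) (∈-allFin s)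
      (λ r r≢s → cong (λ z → χ (z ∧ φ (x <ᵇ lab r))) (≡ᵇ-false (r≢s ∘ a-injective))))
    (cong (λ z → χ (z ∧ φ (x <ᵇ lab s))) (≡ᵇ-true {a s} refl)))

  module _ (c : Filling n → Fin n → ℕ) (pick : BTree → BTree → BTree)
           (Desc-pick : ∀ {l r} s → Desc a b 0 (pred (a s)) l → Desc a b 0 (pred (b s)) r →
                        Desc a b 0 (pred (c τ s)) (pick l r))
           (c-injective : ∀ {r s} → c τ r ≡ c τ s → r ≡ s) (c≤a : ∀ s → c τ s ≤ a s)
           (φ : Bool → Bool) (rel : Fin n → Fin n → Bool)
           (φ-rel : ∀ s r → s ≢ r → φ (toℕ s <ᵇ toℕ r) ≡ rel s r) where

    edge : Fin n → Fin n → ℕ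
    edge s r = χ ((a r ≡ᵇ pred (c τ s)) ∧ φ (lab s <ᵇ lab r))

    edges-∑ : ∀ {p t} (d : Desc a b 0 p t) → edges pick φ t ≡ ∑ (λ s → ∑ (edge s) (rows n)) (rowsOf d)
    edges-∑ (leaf _) = refl
    edges-∑ (node {l} {r} s _ dl dr) = begin
      edgeTo φ (lab s) (pick l r) + edges pick φ l + edges pick φ r
        ≡⟨ cong₂ _+_ (cong₂ _+_ (edgeTo-∑ φ (lab s) (Desc-pick s dl dr)) (edges-∑ dl)) (edges-∑ dr) ⟩
      E s + ∑ E (rowsOf dl) + ∑ E (rowsOf dr)
        ≡⟨ cong (_+ ∑ E (rowsOf dr)) (+-comm (E s) (∑ E (rowsOf dl))) ⟩
      ∑ E (rowsOf dl) + E s + ∑ E (rowsOf dr)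
        ≡⟨ +-assoc (∑ E (rowsOf dl)) (E s) (∑ E (rowsOf dr)) ⟩
      ∑ E (rowsOf dl) + ∑ E (s ∷ rowsOf dr)
        ≡⟨ ∑-++ E (rowsOf dl) (s ∷ rowsOf dr) ⟨
      ∑ E (rowsOf dl ++ s ∷ rowsOf dr) ∎
      where
      open ≡-Reasoning
      E : Fin n → ℕ
      E s = ∑ (edge s) (rows n)

    not-pred : ∀ s r → c τ s ≢ suc (a r) → a r ≢ pred (c τ s)
    not-pred s r neq with c τ s
    -- Truncation makes `pred 0` equal to 0, but no first entry is 0.
    ... | zero  = <⇒≢ (a>0 r) ∘ sym
    ... | suc m = λ eq → neq (cong suc (sym eq))

    edge-des : ∀ s r → edge s r ≡ χ (rel s r ∧ (c τ s ≡ᵇ suc (a r)))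
    edge-des s r with c τ s ≟ suc (a r)
    ... | yes eq rewrite ≡ᵇ-true (cong pred (sym eq)) | ≡ᵇ-true eq | ∧-identityʳ (rel s r) =
      -- The rows differ, since `s = r` would give `c τ s = a s + 1`, against `c≤a`. Distinctness
      -- matters because `not` of a strict comparison also holds on equality.
      cong χ (φ-rel s r λ { refl → <⇒≱ (n<1+n (a s)) (subst (_≤ a s) eq (c≤a s)) })
    ... | no neq rewrite ≡ᵇ-false neq | ∧-zeroʳ (rel s r) | ≡ᵇ-false {a r} {pred (c τ s)} (not-pred s r neq) = refl

    -- A pair with `c τ s = a r + 1` is a descent at the entry of `r` and also an edge from parent
    -- `s` to child `r`. Hence both counts are one double sum, taken in the two orders; `s` above
    -- `r` means that the label grows along the edge.
    length-desGen-edges : ∀ {t} → Desc a b 0 (2 * n) t → length (desGen c rel τ) ≡ edges pick φ t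
    length-desGen-edges {t} d = begin
      length (desGen c rel τ)
        ≡⟨ length-desGen c rel τ c-injective ⟩
      ∑ (λ r → ∑ (λ s → χ (rel s r ∧ (c τ s ≡ᵇ suc (a r)))) (rows n)) (rows n)
        ≡⟨ ∑-cong (λ r → ∑-cong (λ s → edge-des s r) (rows n)) (rows n) ⟨
      ∑ (λ r → ∑ (λ s → edge s r) (rows n)) (rows n)
        ≡⟨ ∑-swap edge (rows n) (rows n) ⟨
      ∑ (λ s → ∑ (edge s) (rows n)) (rows n)
        ≡⟨ ∑-↭ _ (rowsOf-↭ good d) ⟨
      ∑ (λ s → ∑ (edge s) (rows n)) (rowsOf d)
        ≡⟨ edges-∑ d ⟨
      edges pick φ t ∎
      where open ≡-Reasoning

  not-<ᵇ : ∀ {m k} → m ≢ k → not (m <ᵇ k) ≡ (k <ᵇ m)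
  not-<ᵇ {zero}  {zero}  neq = contradiction refl neq
  not-<ᵇ {zero}  {suc k} neq = refl
  not-<ᵇ {suc m} {zero}  neq = refl
  not-<ᵇ {suc m} {suc k} neq = not-<ᵇ (neq ∘ cong suc)

  statistics : ∀ {t} → Desc a b 0 (2 * n) t →
    (length (desN τ) , length (desS τ) , length (desNE τ) , length (desSE τ)) ≡ (lasc t , ldes t , rasc t , rdes t)
  statistics {t} d = cong₂ _,_
    (trans (length-desGen-edges col1 left (λ _ dl _ → dl) a-injective (λ _ → ≤-refl) id above (λ _ _ _ → refl) d)
           (sym (lasc-edges t)))
    (cong₂ _,_
      (trans (length-desGen-edges col1 left (λ _ dl _ → dl) a-injective (λ _ → ≤-refl) not below φ-below d)
             (sym (ldes-edges t)))
      (cong₂ _,_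
        (trans (length-desGen-edges col2 right (λ _ _ dr → dr) b-injective (<⇒≤ ∘ b<a) id above (λ _ _ _ → refl) d)
               (sym (rasc-edges t)))
        (trans (length-desGen-edges col2 right (λ _ _ dr → dr) b-injective (<⇒≤ ∘ b<a) not below φ-below d)
               (sym (rdes-edges t)))))
    where
    φ-below : ∀ s r → s ≢ r → not (toℕ s <ᵇ toℕ r) ≡ below s r
    φ-below s r s≢r = not-<ᵇ (s≢r ∘ toℕ-injective)

-- Traversal of a labelled tree

Bag : Set
Bag = List (ℕ × BTree)

-- Gen t bag w: the word w, read from right to left, of a path whose remaining
-- tree consists of the subtree t to be entered next and, for every open
-- down-step j, the pair of j and the right subtree of the node j.
data Gen : BTree → Bag → List LStep → Set where
  []   : Gen leaf [] []
  dn   : ∀ {l x r bag w} → Gen l ((x , r) ∷ bag) w → Gen (node l x r) bag (downL x ∷ w)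
  up′  : ∀ {j r bag bag′ w} → bag ↭ (j , r) ∷ bag′ → All ((j ≤_) ∘ proj₁) bag′ →
         Gen r bag′ w → Gen leaf bag (upL j ∷ w)

extractMin : ∀ c bag → ∃ λ j → ∃ λ (r : BTree) → ∃ λ bag′ →
             c ∷ bag ↭ (j , r) ∷ bag′ × All ((j ≤_) ∘ proj₁) bag′
extractMin (j , r) []        = j , r , [] , ↭-refl , []
extractMin (j , r) (c ∷ bag) with extractMin c bag
... | j′ , r′ , bag′ , p , min with ≤-total j j′
...   | inj₁ j≤j′ = j , r , c ∷ bag , ↭-refl ,
                    Perm.All-resp-↭ (↭-sym p) (j≤j′ ∷ All.map (≤-trans j≤j′) min)
...   | inj₂ j′≤j = j′ , r′ , (j , r) ∷ bag′ ,
                    ↭-trans (prep _ p) (↭-swap _ _ ↭-refl) , j′≤j ∷ min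

stepCount : BTree → ℕ
stepCount leaf         = 0
stepCount (node l _ r) = suc (stepCount l + suc (stepCount r))

bagCount : Bag → ℕ
bagCount = ∑ (suc ∘ stepCount ∘ proj₂)

-- Induction on the number of steps still to be emitted: two for every node not yet entered and one
-- for the pending up-step of every open node.
generate : ∀ k t bag → stepCount t + bagCount bag ≡ k → ∃ λ w → Gen t bag w
generate zero    leaf         []        _  = [] , []
generate (suc k) (node l x r) bag       eq =
  let w , g = generate k l ((x , r) ∷ bag) (trans (sym (+-assoc (stepCount l) _ _)) (suc-injective eq))
  in downL x ∷ w , dn g
generate (suc k) leaf         (c ∷ bag) eq with extractMin c bag
... | j , r , bag′ , p , min =
  let w , g = generate k r bag′ (suc-injective (trans (sym (∑-↭ (suc ∘ stepCount ∘ proj₂) p)) eq))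
  in upL j ∷ w , up′ p min g

downUp : ℕ → List LStep
downUp x = downL x ∷ upL x ∷ []

treeSteps : BTree → List LStep
treeSteps t = concatMap downUp (labels t)

bagSteps : Bag → List LStep
bagSteps []              = []
bagSteps ((j , r) ∷ bag) = (upL j ∷ treeSteps r) ++ bagSteps bag

bagSteps-↭ : ∀ {bag bag′} → bag ↭ bag′ → bagSteps bag ↭ bagSteps bag′
bagSteps-↭ _↭_.refl                = ↭-refl
bagSteps-↭ (prep (j , r) p)        = Perm.++⁺ˡ (upL j ∷ treeSteps r) (bagSteps-↭ p)
bagSteps-↭ (_↭_.swap (j , r) (j′ , r′) p) =
  ↭-trans (Perm.shifts (upL j ∷ treeSteps r) (upL j′ ∷ treeSteps r′))
    (Perm.++⁺ˡ (upL j′ ∷ treeSteps r′) (Perm.++⁺ˡ (upL j ∷ treeSteps r) (bagSteps-↭ p)))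
bagSteps-↭ (_↭_.trans p q)         = ↭-trans (bagSteps-↭ p) (bagSteps-↭ q)

-- Every node is entered once and closed once, while an open node owes only its up-step.
Gen-↭ : ∀ {t bag w} → Gen t bag w → w ↭ treeSteps t ++ bagSteps bag
Gen-↭ []            = ↭-refl
Gen-↭ (dn {l} {x} {r} {bag} {w} g) = begin
  downL x ∷ w                                                      <⟨ Gen-↭ g ⟩
  downL x ∷ treeSteps l ++ upL x ∷ treeSteps r ++ bagSteps bag     ↭⟨ shift (downL x) (treeSteps l) _ ⟨
  treeSteps l ++ downL x ∷ upL x ∷ treeSteps r ++ bagSteps bag     ≡⟨ ++-assoc (treeSteps l) _ _ ⟨
  (treeSteps l ++ downL x ∷ upL x ∷ treeSteps r) ++ bagSteps bag
    ≡⟨ cong (_++ bagSteps bag) (concatMap-++ downUp (labels l) (x ∷ labels r)) ⟨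
  treeSteps (node l x r) ++ bagSteps bag                           ∎
  where open PermutationReasoning
Gen-↭ (up′ p _ g)   = ↭-trans (prep _ (Gen-↭ g)) (↭-sym (bagSteps-↭ p))

Gen-up-open : ∀ {t bag w i} → Gen t bag w → i ∈ map proj₁ bag → upL i ∈ w
Gen-up-open (dn g)       i∈ = there (Gen-up-open g (there i∈))
Gen-up-open (up′ p _ g)  i∈ with ∈-resp-↭ (Perm.map⁺ proj₁ p) i∈
... | here refl = here refl
... | there i∈′ = there (Gen-up-open g i∈′)

-- Positions in a word without repetition

infix 4 _≟ᴸ_
_≟ᴸ_ : DecidableEquality LStep
upL i   ≟ᴸ upL j   = map′ (cong upL) (λ { refl → refl }) (i ≟ j)
upL i   ≟ᴸ downL j = no λ ()
downL i ≟ᴸ upL j   = no λ ()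
downL i ≟ᴸ downL j = map′ (cong downL) (λ { refl → refl }) (i ≟ j)

-- Words are read from right to left, so a step's position in the path is the
-- length of the suffix of w starting with it.
pos : LStep → List LStep → ℕ
pos e []       = 0
pos e (f ∷ w) with e ≟ᴸ f
... | yes _ = suc (length w)
... | no  _ = pos e w

pos-here : ∀ e w → pos e (e ∷ w) ≡ suc (length w)
pos-here e w with e ≟ᴸ e
... | yes _  = refl
... | no e≢e = contradiction refl e≢e

pos-there : ∀ {e f} w → e ≢ f → pos e (f ∷ w) ≡ pos e w
pos-there {e} {f} w e≢f with e ≟ᴸ f
... | yes e≡f = contradiction e≡f e≢f
... | no  _   = refl

pos≤length : ∀ e w → pos e w ≤ length w
pos≤length e []      = z≤n
pos≤length e (f ∷ w) with e ≟ᴸ f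
... | yes _ = ≤-refl
... | no  _ = m≤n⇒m≤1+n (pos≤length e w)

map-pos : ∀ {w} → Unique w → map (λ e → pos e w) w ≡ desc (length w)
map-pos {[]}    _        = refl
map-pos {e ∷ w} (e∉ ∷ u) = cong₂ _∷_ (pos-here e w)
  (trans (map-cong-local (All.map (λ e≢f → pos-there w (e≢f ∘ sym)) e∉)) (map-pos u))

pos-injective : ∀ {w e f} → Unique w → e ∈ w → f ∈ w → pos e w ≡ pos f w → e ≡ f
pos-injective {w} u = Unique-map⇒injective (λ e → pos e w)
  (subst Unique (sym (map-pos u)) (Unique-resp-↭ (↭-sym (desc↭range1 (length w))) (range1-unique (length w))))

-- The positions form a filling with the given tree

module _ (W : List LStep) where

  -- Records what follows when `w` is a final segment of `W`: positions may be measured in either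
  -- word.
  record Suffix (w : List LStep) : Set where
    field
      unique : Unique w
      ∈W     : ∀ {e} → e ∈ w → e ∈ W
      pos≡   : ∀ {e} → e ∈ w → pos e W ≡ pos e w

    pos≤ : ∀ {e} → e ∈ w → pos e W ≤ length w
    pos≤ e∈ = subst (_≤ length w) (sym (pos≡ e∈)) (pos≤length _ w)

  open Suffix

  pos-head : ∀ {e w} → Suffix (e ∷ w) → pos e W ≡ suc (length w)
  pos-head {e} {w} s = trans (pos≡ s (here refl)) (pos-here e w)

  tail : ∀ {e w} → Suffix (e ∷ w) → Suffix w
  tail {e} {w} s with unique s
  ... | e∉ ∷ u = record
    { unique = u
    ; ∈W     = ∈W s ∘ there
    ; pos≡   = λ f∈ → trans (pos≡ s (there f∈)) (pos-there w (All.lookup e∉ f∈ ∘ sym))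
    }

  pos-tail : ∀ {e f w} → Suffix (e ∷ w) → f ∈ w → pos f W < pos e W
  pos-tail s f∈ = subst (_ <_) (sym (pos-head s)) (s≤s (pos≤ (tail s) f∈))

  -- A node enters the bag with its down-step and leaves it with its up-step, which is therefore
  -- read later and has the smaller position.
  Gen-decreasing : ∀ {t bag w i} → Gen t bag w → Suffix w → downL i ∈ w → pos (upL i) W < pos (downL i) W
  Gen-decreasing (dn g)      s (here refl) = pos-tail s (Gen-up-open g (here refl))
  Gen-decreasing (dn g)      s (there i∈)  = Gen-decreasing g (tail s) i∈
  Gen-decreasing (up′ _ _ g) s (there i∈)  = Gen-decreasing g (tail s) i∈

  -- While `i` is open the larger label `r` cannot be the least open one, so `i` is closed first.
  Gen-open-triple : ∀ {t bag w i r} → Gen t bag w → Suffix w → i ∈ map proj₁ bag → upL r ∈ w → i < r →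
                    pos (upL r) W < pos (upL i) W
  Gen-open-triple (dn g)        s i∈ (there r∈) i<r = Gen-open-triple g (tail s) (there i∈) r∈ i<r
  Gen-open-triple (up′ p min g) s i∈ r∈         i<r with ∈-resp-↭ (Perm.map⁺ proj₁ p) i∈ | r∈
  ... | here refl  | here refl  = contradiction i<r (<-irrefl refl)
  ... | here refl  | there r∈′  = pos-tail s r∈′
  ... | there i∈′  | there r∈′  = Gen-open-triple g (tail s) i∈′ r∈′ i<r
  ... | there i∈′  | here refl with ∈-map⁻ proj₁ i∈′
  ...   | _ , c∈ , refl = contradiction i<r (≤⇒≯ (All.lookup min c∈))

  -- The inequality of positions says that `r` is closed after `i` is entered; from that moment `i`
  -- is open and `Gen-open-triple` applies.
  Gen-triple : ∀ {t bag w i r} → Gen t bag w → Suffix w → downL i ∈ w → upL r ∈ w → i < r →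
               pos (upL r) W ≤ pos (downL i) W → pos (upL r) W < pos (upL i) W
  Gen-triple (dn g)      s (here refl) (there r∈)  i<r _   = Gen-open-triple g (tail s) (here refl) r∈ i<r
  Gen-triple (dn g)      s (there i∈)  (there r∈)  i<r r≤i = Gen-triple g (tail s) i∈ r∈ i<r r≤i
  Gen-triple (up′ _ _ g) s (there i∈)  (here refl) i<r r≤i = contradiction r≤i (<⇒≱ (pos-tail s i∈))
  Gen-triple (up′ _ _ g) s (there i∈)  (there r∈)  i<r r≤i = Gen-triple g (tail s) i∈ r∈ i<r r≤i

  module _ {n : ℕ} {a b : Fin n → ℕ}
           (a≡ : ∀ r → a r ≡ pos (downL (lab r)) W) (b≡ : ∀ r → b r ≡ pos (upL (lab r)) W)
           (uniqueW : Unique W) (down∈ : ∀ (r : Fin n) → downL (lab r) ∈ W)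
           (down-lab : ∀ {x} → downL x ∈ W → ∃ λ (r : Fin n) → x ≡ lab r) where

    -- The subtree to be entered next hangs at the current position, and a subtree in the bag hangs
    -- just left of the up-step of its node. At an up-step the current subtree is a leaf, as no
    -- down-step has that position.
    Gen-Desc : ∀ {t bag w} → Gen t bag w → Suffix w →
               Desc a b 0 (length w) t × All (λ (j , r) → Desc a b 0 (pred (pos (upL j) W)) r) bag
    Gen-Desc []     s = leaf (λ _ _ → z≤n) , []
    Gen-Desc (dn g) s with Gen-Desc g (tail s) | down-lab (∈W s (here refl))
    ... | dl , dr ∷ dbag | q , refl = subst (λ p → Desc a b 0 p _) aq≡
            (node q (subst (0 <_) (sym aq≡) z<s)
              (subst (λ p → Desc a b 0 p _) (cong pred (sym aq≡)) dl)
              (subst (λ p → Desc a b 0 (pred p) _) (sym (b≡ q)) dr)) , dbag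
      where aq≡ = trans (a≡ q) (pos-head s)
    Gen-Desc (up′ {j} p _ g) s with Gen-Desc g (tail s)
    ... | dr , dbag =
      leaf not-down ,
      Perm.All-resp-↭ (↭-sym p) (subst (λ q → Desc a b 0 (pred q) _) (sym (pos-head s)) dr ∷ dbag)
      where
      not-down : ∀ r → a r ≡ _ → _ ≤ 0
      not-down r ar≡ with () ← pos-injective uniqueW (down∈ r) (∈W s (here refl))
                                 (trans (sym (a≡ r)) (trans ar≡ (sym (pos-head s))))

-- Surjectivity: the filling of a tree

Desc-surjective : ∀ {n} T → IsLTree n T → ∃ λ (τ : Filling n) → IsSPCT n τ × Desc (col1 τ) (col2 τ) 0 (2 * n) T
Desc-surjective {n} T isL = τ , spct , subst (λ k → Desc (col1 τ) (col2 τ) 0 k T) length-W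
    (proj₁ (Gen-Desc W col1≡ col2≡ uniqueW down∈ down-lab gen whole))
  where
  generated : ∃ λ w → Gen T [] w
  generated = generate _ T [] refl
  W : List LStep
  W = proj₁ generated
  gen : Gen T [] W
  gen = proj₂ generated
  labs : List ℕ
  labs = map lab (allFin n)
  W↭ : W ↭ map downL labs ++ map upL labs
  W↭ = begin
    W                              ↭⟨ Gen-↭ gen ⟩
    treeSteps T ++ []              ≡⟨ ++-identityʳ (treeSteps T) ⟩
    concatMap downUp (labels T)    ↭⟨ concatMap-pair-↭ downL upL (labels T) ⟩
    map downL (labels T) ++ map upL (labels T)
      ↭⟨ Perm.++⁺ (Perm.map⁺ downL labels↭) (Perm.map⁺ upL labels↭) ⟩
    map downL labs ++ map upL labs ∎
    where
    open PermutationReasoning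
    labels↭ : labels T ↭ labs
    labels↭ = ↭-trans isL (↭-reflexive (sym (map-lab-allFin n)))
  uniqueW : Unique W
  uniqueW = Unique-resp-↭ (↭-sym W↭) (Unique.++⁺ (Unique.map⁺ (λ { refl → refl }) labs-unique)
    (Unique.map⁺ (λ { refl → refl }) labs-unique) disjoint)
    where
    labs-unique : Unique labs
    labs-unique = Unique.map⁺ lab-injective (Unique.allFin⁺ n)
    disjoint : ∀ {e} → ¬ (e ∈ map downL labs × e ∈ map upL labs)
    disjoint (e∈ , e∈′) with ∈-map⁻ downL e∈ | ∈-map⁻ upL e∈′
    ... | _ , _ , refl | _ , _ , ()
  down∈ : ∀ r → downL (lab r) ∈ W
  down∈ r = ∈-resp-↭ (↭-sym W↭) (∈-++⁺ˡ (∈-map⁺ downL (∈-map⁺ lab (∈-allFin r))))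
  up∈ : ∀ r → upL (lab r) ∈ W
  up∈ r = ∈-resp-↭ (↭-sym W↭) (∈-++⁺ʳ (map downL labs) (∈-map⁺ upL (∈-map⁺ lab (∈-allFin r))))
  down-lab : ∀ {x} → downL x ∈ W → ∃ λ (r : Fin n) → x ≡ lab r
  down-lab x∈ with ∈-++⁻ (map downL labs) (∈-resp-↭ W↭ x∈)
  ... | inj₂ x∈′ with () ← proj₂ (proj₂ (∈-map⁻ upL x∈′))
  ... | inj₁ x∈′ with ∈-map⁻ downL x∈′
  ...   | _ , y∈ , refl = let r , _ , eq = ∈-map⁻ lab y∈ in r , eq
  whole : Suffix W W
  whole = record { unique = uniqueW ; ∈W = id ; pos≡ = λ _ → refl }
  length-W : length W ≡ 2 * n
  length-W = begin
    length W                                          ≡⟨ Perm.↭-length W↭ ⟩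
    length (map downL labs ++ map upL labs)           ≡⟨ length-++ (map downL labs) ⟩
    length (map downL labs) + length (map upL labs)
      ≡⟨ cong₂ _+_ (trans (length-map downL labs) length-labs) (trans (length-map upL labs) length-labs) ⟩
    n + n                                             ≡⟨ cong (n +_) (+-identityʳ n) ⟨
    2 * n                                             ∎
    where
    open ≡-Reasoning
    length-labs : length labs ≡ n
    length-labs = trans (length-map lab (allFin n)) (length-tabulate id)
  τ : Filling n
  τ = Vec.tabulate λ r → pos (downL (lab r)) W , pos (upL (lab r)) W
  col1≡ : ∀ r → col1 τ r ≡ pos (downL (lab r)) W
  col1≡ r = cong proj₁ (lookup∘tabulate _ r)
  col2≡ : ∀ r → col2 τ r ≡ pos (upL (lab r)) W
  col2≡ r = cong proj₂ (lookup∘tabulate _ r)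
  entries↭ : entries τ ↭ range1 (2 * n)
  entries↭ = begin
    entries τ
      ↭⟨ entries-↭ τ ⟩
    map (col1 τ) (rows n) ++ map (col2 τ) (rows n)
      ≡⟨ cong₂ _++_ (column downL col1≡) (column upL col2≡) ⟩
    map posW (map downL labs) ++ map posW (map upL labs)
      ≡⟨ map-++ posW (map downL labs) (map upL labs) ⟨
    map posW (map downL labs ++ map upL labs)
      ↭⟨ Perm.map⁺ posW W↭ ⟨
    map posW W
      ≡⟨ map-pos uniqueW ⟩
    desc (length W)
      ↭⟨ desc↭range1 (length W) ⟩
    range1 (length W)
      ≡⟨ cong range1 length-W ⟩
    range1 (2 * n) ∎
    where
    open PermutationReasoning
    posW : LStep → ℕ
    posW e = pos e W
    column : ∀ {c : Fin n → ℕ} (f : ℕ → LStep) → (∀ r → c r ≡ posW (f (lab r))) →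
             map c (rows n) ≡ map posW (map f labs)
    column f eq = trans (map-cong eq (rows n))
      (trans (map-∘ (rows n)) (cong (map posW) (map-∘ (rows n))))
  spct : IsSPCT n τ
  spct = record
    -- The name `distinct-1..2n` in the record declares two fields of the same type, so the
    -- permutation is supplied for both.
    { distinct-1    = entries↭
    ; 2n            = entries↭
    ; rows-decrease = λ i → subst₂ _<_ (sym (col2≡ i)) (sym (col1≡ i)) (Gen-decreasing W gen whole (down∈ i))
    ; triple        = λ i r i<r r≤i → subst₂ _<_ (sym (col2≡ r)) (sym (col2≡ i))
        (Gen-triple W gen whole (down∈ i) (up∈ r) (s<s i<r) (subst₂ _≤_ (col2≡ r) (col1≡ i) r≤i))
    }

-- Bijectivity and equality of the statistics

theorem4p8 : ∀ (n : ℕ) → 1 ≤ n →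
    ( (∀ (τ : Filling n) → IsSPCT n τ → IsLTree n (ΛΦ τ))
    × (∀ (τ σ : Filling n) → IsSPCT n τ → IsSPCT n σ → ΛΦ τ ≡ ΛΦ σ → τ ≡ σ)
    × (∀ (T : BTree) → IsLTree n T → ∃ λ (τ : Filling n) → IsSPCT n τ × ΛΦ τ ≡ T) )
    × (∀ (τ : Filling n) → IsSPCT n τ →
    (length (desN τ) , length (desS τ) , length (desNE τ) , length (desSE τ))
    ≡ (lasc (ΛΦ τ) , ldes (ΛΦ τ) , rasc (ΛΦ τ) , rdes (ΛΦ τ)))
theorem4p8 n _ = (isLTree , injective , surjective) , stats
  where
  isLTree : ∀ τ → IsSPCT n τ → IsLTree n (ΛΦ τ)
  isLTree τ spct = Desc-IsLTree (SPCT⇒Good {τ = τ} spct) (Desc-ΛΦ {τ = τ} (SPCT⇒Good {τ = τ} spct))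
  injective : ∀ (τ σ : Filling n) → IsSPCT n τ → IsSPCT n σ → ΛΦ τ ≡ ΛΦ σ → τ ≡ σ
  injective τ σ spctτ spctσ eq = begin
    τ                         ≡⟨ tabulate∘lookup τ ⟨
    Vec.tabulate (lookup τ)   ≡⟨ tabulate-cong (λ r → cong₂ _,_ (proj₁ (same r)) (proj₂ (same r))) ⟩
    Vec.tabulate (lookup σ)   ≡⟨ tabulate∘lookup σ ⟩
    σ                         ∎
    where
    open ≡-Reasoning
    goodτ = SPCT⇒Good {τ = τ} spctτ
    goodσ = SPCT⇒Good {τ = σ} spctσ
    same : ∀ r → col1 τ r ≡ col1 σ r × col2 τ r ≡ col2 σ r
    same = Desc-injective goodτ goodσ (Desc-ΛΦ {τ = τ} goodτ)
             (subst (Desc (col1 σ) (col2 σ) 0 (2 * n)) (sym eq) (Desc-ΛΦ {τ = σ} goodσ))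
  surjective : ∀ (T : BTree) → IsLTree n T → ∃ λ (τ : Filling n) → IsSPCT n τ × ΛΦ τ ≡ T
  surjective T isL with Desc-surjective T isL
  ... | τ , spct , d = τ , spct ,
    -- Both `ΛΦ τ` and `T` are trees of `τ` with root entry `2 * n`, hence equal.
    Desc-functional (Good.a-injective good) refl (Desc-ΛΦ {τ = τ} good) d
    where good = SPCT⇒Good {τ = τ} spct
  stats : ∀ τ → IsSPCT n τ →
    (length (desN τ) , length (desS τ) , length (desNE τ) , length (desSE τ))
    ≡ (lasc (ΛΦ τ) , ldes (ΛΦ τ) , rasc (ΛΦ τ) , rdes (ΛΦ τ))
  stats τ spct = statistics {τ = τ} good (Desc-ΛΦ {τ = τ} good)
    where good = SPCT⇒Good {τ = τ} spct
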